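{- Let $G=(V,E)$ be a finite graph. Suppose that $A,B,C\subseteq E$ are chosen independently and uniformly at random, and let $\Delta$ be the event that $A,B,C$ have pairwise eulerian symmetric differences (i.e. $A\bigtriangleup B$, $B\bigtriangleup C$, $C\bigtriangleup A$ are all eulerian). Then the event that $|A|+|B|+|C|\equiv 0,1,2 \pmod 6$ (i.e. that $\left\lfloor\frac{|A|+|B|+|C|}{3}\right\rfloor$ is even) is correlated with $\Delta$ as follows: $$\frac{\mathrm{Bias}(|A|+|B|+|C|\equiv 0,1,2\ (\mathrm{mod}\ 6)\,\mid\,\Delta)}{\mathrm{Bias}(|A|+|B|+|C|\equiv 0,1,2\ (\mathrm{mod}\ 6))}=3^{ -|E|}\,4^{r(G)}\,F(G;4).$$
   Context: Graphs are finite; loops and parallel edges are permitted. A subset $A\subseteq E$ is identified with the subgraph $(V,A)$ of $G$; it is called eulerian if all its vertex degrees are even (a loop contributes 2 to the degree). $\bigtriangleup$ is symmetric difference of sets. $r(G)=|V|-k(G)$, where $k(G)$ is the number of connected components of $G$. $F(G;q)$ is the number of nowhere-zero $\mathbb{Z}_q$-flows of $G$ (with respect to any fixed orientation). For an event $\Sigma$, $\mathrm{Bias}(\Sigma)=\mathbb{P}(\Sigma)-\mathbb{P}(\overline{\Sigma})$ and $\mathrm{Bias}(\Sigma\mid\Delta)=\mathbb{P}(\Sigma\mid\Delta)-\mathbb{P}(\overline{\Sigma}\mid\Delta)$, where $\overline{\Sigma}$ is the complement of $\Sigma$. -}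

module Defs where

open import Data.Bool.Base using (Bool; true; false; if_then_else_)
open import Data.Fin.Base using (Fin; zero; suc; toℕ)
open import Data.Fin.Properties using (_≟_; all?)
open import Data.Fin.Subset using (Subset; ⊥; _∪_; _─_; ∣_∣)
open import Data.Integer.Base using (+_)
open import Data.List.Base
  using (List; []; _∷_; length; filter; deduplicate; allFin; cartesianProduct; cartesianProductWith)
open import Data.List.Membership.Propositional using (_∈_)
open import Data.List.Membership.Propositional.Properties
  using (∈-cartesianProduct⁺; ∈-cartesianProductWith⁺)
open import Data.List.Relation.Unary.Any using (here; there)
open import Data.Nat.Base as ℕ using (ℕ; zero; suc; _+_; _∸_; _%_; NonZero)
open import Data.Nat.Divisibility using (_∣_; _∣?_)
import Data.Nat.Properties as ℕ
open import Data.Product.Base using (_×_; _,_; ∃)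
open import Data.Rational.Base as ℚ using (ℚ; _/_; _-_; _÷_)
open import Data.Sum.Base using (_⊎_; inj₁; inj₂)
open import Data.Vec.Base as Vec using (Vec; []; _∷_; lookup)
open import Data.Vec.Functional using (Vector)
open import Algebra.Properties.CommutativeMonoid.Sum ℕ.+-0-commutativeMonoid using (sum)
open import Level using (Level; 0ℓ)
open import Relation.Binary.Core using (Rel)
import Relation.Binary.Definitions as Binary
open import Relation.Binary.Structures using (IsEquivalence)
open import Relation.Binary.Construct.Closure.Equivalence as Eq using (EqClosure)
open import Relation.Binary.PropositionalEquality using (_≡_; _≢_; refl; isEquivalence)
open import Relation.Nullary.Decidable using (Dec; ¬?; does; map′; _×-dec_; _⊎-dec_)
open import Relation.Unary using (Pred; Decidable)
open import Relation.Unary.Properties using (∁?; _∩?_)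

private
  variable
    a ℓ ℓ′ : Level
    X : Set a
    n m : ℕ

-- Loops and parallel edges are allowed.  The order of the two endpoints of
-- an edge serves only as the reference orientation for flows; every
-- orientation of a graph arises by choosing `tail` and `head` suitably.
record Graph : Set where
  field
    ∣V∣ ∣E∣ : ℕ
    tail head : Fin ∣E∣ → Fin ∣V∣

  V E : Set
  V = Fin ∣V∣
  E = Fin ∣E∣

  EdgeSet : Set
  EdgeSet = Subset ∣E∣

module _ (tl hd : Fin m → Fin n) where

  Joined : Rel (Fin n) 0ℓ
  Joined u v = ∃ λ e → tl e ≡ u × hd e ≡ v

-- Decidability of connectedness, adding one edge s–t at a time: a path
-- either avoids the new edge or uses it once, in one of two directions.
private
  module AddEdge (tl hd : Fin (suc m) → Fin n) where

    s t : Fin n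
    s = tl zero
    t = hd zero

    _~_ : Rel (Fin n) 0ℓ
    _~_ = EqClosure (Joined (λ e → tl (suc e)) (λ e → hd (suc e)))

    _≈_ : Rel (Fin n) 0ℓ
    u ≈ v = (u ~ v) ⊎ ((u ~ s × t ~ v) ⊎ (u ~ t × s ~ v))

    ~-sym : ∀ {u v} → u ~ v → v ~ u
    ~-sym = Eq.symmetric _

    _∙_ : ∀ {u v w} → u ~ v → v ~ w → u ~ w
    _∙_ = Eq.transitive _

    ≈-sym : ∀ {u v} → u ≈ v → v ≈ u
    ≈-sym (inj₁ p)              = inj₁ (~-sym p)
    ≈-sym (inj₂ (inj₁ (p , q))) = inj₂ (inj₂ (~-sym q , ~-sym p))
    ≈-sym (inj₂ (inj₂ (p , q))) = inj₂ (inj₁ (~-sym q , ~-sym p))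

    ≈-trans : ∀ {u v w} → u ≈ v → v ≈ w → u ≈ w
    ≈-trans (inj₁ p) (inj₁ q)                            = inj₁ (p ∙ q)
    ≈-trans (inj₁ p) (inj₂ (inj₁ (q , r)))               = inj₂ (inj₁ (p ∙ q , r))
    ≈-trans (inj₁ p) (inj₂ (inj₂ (q , r)))               = inj₂ (inj₂ (p ∙ q , r))
    ≈-trans (inj₂ (inj₁ (p , q))) (inj₁ r)               = inj₂ (inj₁ (p , q ∙ r))
    ≈-trans (inj₂ (inj₁ (p , _))) (inj₂ (inj₁ (_ , r)))  = inj₂ (inj₁ (p , r))
    ≈-trans (inj₂ (inj₁ (p , _))) (inj₂ (inj₂ (_ , r)))  = inj₁ (p ∙ r)
    ≈-trans (inj₂ (inj₂ (p , q))) (inj₁ r)               = inj₂ (inj₂ (p , q ∙ r))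
    ≈-trans (inj₂ (inj₂ (p , _))) (inj₂ (inj₁ (_ , r)))  = inj₁ (p ∙ r)
    ≈-trans (inj₂ (inj₂ (p , _))) (inj₂ (inj₂ (_ , r)))  = inj₂ (inj₂ (p , r))

    ≈-isEquivalence : IsEquivalence _≈_
    ≈-isEquivalence = record
      { refl = inj₁ (Eq.reflexive _) ; sym = ≈-sym ; trans = ≈-trans }

    joined⇒≈ : ∀ {u v} → Joined tl hd u v → u ≈ v
    joined⇒≈ (zero  , refl , refl) = inj₂ (inj₁ (Eq.reflexive _ , Eq.reflexive _))
    joined⇒≈ (suc e , p    , q)    = inj₁ (Eq.return (e , p , q))

    to : ∀ {u v} → EqClosure (Joined tl hd) u v → u ≈ v
    to = Eq.fold ≈-isEquivalence joined⇒≈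

    weaken : ∀ {u v} → u ~ v → EqClosure (Joined tl hd) u v
    weaken = Eq.map λ (e , p , q) → suc e , p , q

    new : EqClosure (Joined tl hd) s t
    new = Eq.return (zero , refl , refl)

    from : ∀ {u v} → u ≈ v → EqClosure (Joined tl hd) u v
    from (inj₁ p)              = weaken p
    from (inj₂ (inj₁ (p , q))) = Eq.transitive _ (weaken p) (Eq.transitive _ new (weaken q))
    from (inj₂ (inj₂ (p , q))) =
      Eq.transitive _ (weaken p) (Eq.transitive _ (Eq.symmetric _ new) (weaken q))

eqClosure? : (tl hd : Fin m → Fin n) → Binary.Decidable (EqClosure (Joined tl hd))
eqClosure? {zero}  tl hd u v = map′ (λ { refl → Eq.reflexive _ })
  (Eq.fold isEquivalence λ ()) (u ≟ v)
eqClosure? {suc m} tl hd u v = map′ from to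
  (rec u v ⊎-dec ((rec u s ×-dec rec t v) ⊎-dec (rec u t ×-dec rec s v)))
  where
  open AddEdge tl hd
  rec : Binary.Decidable _~_
  rec = eqClosure? (λ e → tl (suc e)) (λ e → hd (suc e))

module _ (G : Graph) where
  open Graph G

  Connected : Rel V 0ℓ
  Connected = EqClosure (Joined tail head)

  connected? : Binary.Decidable Connected
  connected? = eqClosure? tail head

  -- `deduplicate` keeps exactly one vertex from each connected component.
  k : ℕ
  k = length (deduplicate connected? (allFin ∣V∣))

  -- k ≤ ∣V∣, so the truncated subtraction is exact.
  r : ℕ
  r = ∣V∣ ∸ k

infixl 6 _△_

_△_ : Subset m → Subset m → Subset m
A △ B = (A ─ B) ∪ (B ─ A)

𝟙 : {P : Set ℓ} → Dec P → ℕ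
𝟙 P? = if does P? then 1 else 0

module _ (G : Graph) where
  open Graph G

  degree : EdgeSet → V → ℕ
  degree A v = sum λ e → if lookup A e then 𝟙 (tail e ≟ v) + 𝟙 (head e ≟ v) else 0

  Eulerian : Pred EdgeSet 0ℓ
  Eulerian A = ∀ v → 2 ∣ degree A v

  eulerian? : Decidable Eulerian
  eulerian? A = all? λ v → 2 ∣? degree A v

vectors : List X → ∀ n → List (Vec X n)
vectors xs zero    = [] ∷ []
vectors xs (suc n) = cartesianProductWith _∷_ xs (vectors xs n)

vectors-complete : {xs : List X} → (∀ x → x ∈ xs) → (v : Vec X n) → v ∈ vectors xs n
vectors-complete all∈ []      = here refl
vectors-complete all∈ (x ∷ v) =
  ∈-cartesianProductWith⁺ _∷_ (all∈ x) (vectors-complete all∈ v)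

subsets : ∀ m → List (Subset m)
subsets = vectors (false ∷ true ∷ [])

subsets-complete : (A : Subset m) → A ∈ subsets m
subsets-complete = vectors-complete λ { false → here refl ; true → there (here refl) }

-- ℤ_q is represented by the residues Fin q, and Kirchhoff's law at each
-- vertex is read as a congruence modulo q.
module _ (G : Graph) (q : ℕ) .{{_ : NonZero q}} where
  open Graph G

  inflow outflow : Vec (Fin q) ∣E∣ → V → ℕ
  inflow  f v = sum λ e → if does (head e ≟ v) then toℕ (lookup f e) else 0
  outflow f v = sum λ e → if does (tail e ≟ v) then toℕ (lookup f e) else 0

  NowhereZeroFlow : Pred (Vec (Fin q) ∣E∣) 0ℓ
  NowhereZeroFlow f = (∀ e → toℕ (lookup f e) ≢ 0) × (∀ v → inflow f v % q ≡ outflow f v % q)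

  nowhereZeroFlow? : Decidable NowhereZeroFlow
  nowhereZeroFlow? f =
    all? (λ e → ¬? (toℕ (lookup f e) ℕ.≟ 0)) ×-dec
    all? (λ v → inflow f v % q ℕ.≟ outflow f v % q)

  F : ℕ
  F = length (filter nowhereZeroFlow? (vectors (allFin q) ∣E∣))

-- The uniform distribution on a finite sample space Ω, which must be listed
-- without repetition.
module Uniform (Ω : List X) .{{_ : NonZero (length Ω)}} where

  ℙ : {Σ : Pred X ℓ} → Decidable Σ → ℚ
  ℙ Σ? = + length (filter Σ? Ω) / length Ω

  ℙ[_∣_] : {Σ : Pred X ℓ} {Δ : Pred X ℓ′} (Σ? : Decidable Σ) (Δ? : Decidable Δ) →
           .{{ℚ.NonZero (ℙ Δ?)}} → ℚ
  ℙ[ Σ? ∣ Δ? ] = ℙ (Σ? ∩? Δ?) ÷ ℙ Δ?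

  Bias : {Σ : Pred X ℓ} → Decidable Σ → ℚ
  Bias Σ? = ℙ Σ? - ℙ (∁? Σ?)

  Bias[_∣_] : {Σ : Pred X ℓ} {Δ : Pred X ℓ′} (Σ? : Decidable Σ) (Δ? : Decidable Δ) →
              .{{ℚ.NonZero (ℙ Δ?)}} → ℚ
  Bias[ Σ? ∣ Δ? ] = ℙ[ Σ? ∣ Δ? ] - ℙ[ ∁? Σ? ∣ Δ? ]

module Triple (G : Graph) where
  open Graph G

  Outcome : Set
  Outcome = EdgeSet × EdgeSet × EdgeSet

  -- Independent uniform choices of A, B, C amount to the uniform
  -- distribution on the product.
  Ω : List Outcome
  Ω = cartesianProduct (subsets ∣E∣) (cartesianProduct (subsets ∣E∣) (subsets ∣E∣))

  Ω-complete : (ω : Outcome) → ω ∈ Ω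
  Ω-complete (A , B , C) = ∈-cartesianProduct⁺ (subsets-complete A)
    (∈-cartesianProduct⁺ (subsets-complete B) (subsets-complete C))

  private
    ∈⇒nonZero : {x : X} {xs : List X} → x ∈ xs → NonZero (length xs)
    ∈⇒nonZero (here _)  = _
    ∈⇒nonZero (there _) = _

  instance
    ∣Ω∣-nonZero : NonZero (length Ω)
    ∣Ω∣-nonZero = ∈⇒nonZero (Ω-complete (⊥ , ⊥ , ⊥))

    3^∣E∣-nonZero : NonZero (3 ℕ.^ ∣E∣)
    3^∣E∣-nonZero = ℕ.m^n≢0 3 ∣E∣

  open Uniform Ω public

  PairwiseEulerian : Pred Outcome 0ℓ
  PairwiseEulerian (A , B , C) =
    Eulerian G (A △ B) × Eulerian G (B △ C) × Eulerian G (C △ A)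

  pairwiseEulerian? : Decidable PairwiseEulerian
  pairwiseEulerian? (A , B , C) =
    eulerian? G (A △ B) ×-dec eulerian? G (B △ C) ×-dec eulerian? G (C △ A)

  Sum≡0,1,2mod6 : Pred Outcome 0ℓ
  Sum≡0,1,2mod6 (A , B , C) = let s = (∣ A ∣ + ∣ B ∣ + ∣ C ∣) % 6 in s ≡ 0 ⊎ s ≡ 1 ⊎ s ≡ 2

  sum≡0,1,2mod6? : Decidable Sum≡0,1,2mod6
  sum≡0,1,2mod6? (A , B , C) = let s = (∣ A ∣ + ∣ B ∣ + ∣ C ∣) % 6 in
    (s ℕ.≟ 0) ⊎-dec (s ℕ.≟ 1) ⊎-dec (s ℕ.≟ 2)

{-# OPTIONS --safe #-}
module Submission where

-- Let c(j) = 1 if j ≡ 0, 1, 2 (mod 6) and −1 otherwise, so that both biases average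
-- c(|A| + |B| + |C|), and put (T c)(j) = c(j + 1) + c(j + 2).  As c(j + 3) = − c(j), the
-- shift x satisfies x³ = −1.  Without conditioning, an edge contributes
-- (1 + x)³ = 3(x + x²), that is 3 T.  Given Δ, put X = A △ B and Y = A △ C, two eulerian sets: an edge outside
-- X ∪ Y contributes 1 + x³ = 0, and any other edge contributes T.  Both biases are thus
-- multiples of the same nonzero number (T^∣E∣ c)(0), and the conditional one counts the
-- pairs (X , Y) that cover E, which are the nowhere-zero flows with values in ℤ₂ × ℤ₂.
--
-- The number of nowhere-zero Γ-flows depends only on the order of Γ: releasing the
-- nonzero constraints one edge at a time (a nonzero value is any value except 0) reduces
-- this to the number of all Γ-flows, which is ∣Γ∣^(∣E∣ − r(G)) by induction on the edges.
-- For Γ = ℤ₂ × ℤ₂ this number of all flows also gives the probability of Δ.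

open import Defs
open import Algebra.Bundles using (AbelianGroup)
import Algebra.Properties.AbelianGroup as AbelianGroupProperties
import Algebra.Properties.CommutativeMonoid.Sum as CommutativeMonoidSum
open import Algebra.Structures using (IsAbelianGroup)
open import Data.Bool.Base using (Bool; true; false; not; _∧_; _∨_; _xor_; if_then_else_)
open import Data.Bool.ListAction using (any)
import Data.Bool.Properties as Bool
open import Data.Fin.Base using (Fin; zero; suc; toℕ)
open import Data.Fin.Properties as Fin using (all?; ∀-cons; toℕ-fromℕ<; toℕ-injective)
open import Data.Fin.Subset using (Subset; ∣_∣)
open import Data.Integer.Base as ℤ using (ℤ; _+_; _*_; -_; _-_; _^_; 0ℤ; 1ℤ; -1ℤ)
  renaming (+_ to pos)
open import Data.Integer.Properties as ℤ
  using ( +-identityˡ; +-identityʳ; +-assoc; +-comm; +-inverseʳ; +-0-abelianGroup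
        ; *-identityˡ; *-identityʳ; *-assoc; *-comm; *-zeroʳ; *-distribˡ-+; *-cancelʳ-≡
        ; neg-involutive; neg-distrib-+; i*j≡0⇒i≡0∨j≡0
        ; i^n≡0⇒i≡0; ^-distribˡ-+-*; pos-*)
open import Data.Integer.Tactic.RingSolver using (solve-∀)
open import Data.List.Base
  using ( List; []; _∷_; _++_; length; map; filter; deduplicate; allFin
        ; cartesianProduct; cartesianProductWith)
open import Data.List.Membership.Propositional using (_∈_)
open import Data.List.Membership.Propositional.Properties using (∈-allFin; ∈-map⁺)
open import Data.List.Membership.Propositional.Properties.WithK using (unique∧set⇒bag)
open import Data.List.Properties using (filter-none; filter-reject; length-filter; length-tabulate)
open import Data.List.Relation.Binary.BagAndSetEquality using (∼bag⇒↭)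
open import Data.List.Relation.Binary.Permutation.Propositional as ↭ using (_↭_)
open import Data.List.Relation.Unary.All as All using (All; []; _∷_)
import Data.List.Relation.Unary.All.Properties as All
open import Data.List.Relation.Unary.AllPairs as AllPairs using (AllPairs; []; _∷_)
open import Data.List.Relation.Unary.Any using (here; there)
import Data.List.Relation.Unary.Unique.DecPropositional as DecUnique
open import Data.List.Relation.Unary.Unique.Propositional using (Unique)
open import Data.List.Relation.Unary.Unique.Propositional.Properties using (allFin⁺; map⁺)
open import Data.Nat.Base as ℕ using (ℕ; zero; suc; _%_; _∸_)
open import Data.Nat.Divisibility using (_∣_; _∣0; divides; ∣m∣n⇒∣m+n; ∣-refl)
open import Data.Nat.DivMod using (_mod_; %-distribˡ-+; m%n<n; [m+n]%n≡m%n)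
import Data.Nat.Properties as ℕ
import Data.Nat.Tactic.RingSolver as ℕSolver
open import Data.Product.Base using (_×_; _,_; proj₁; proj₂; Σ-syntax)
open import Data.Product.Properties using (≡-dec)
open import Data.Rational.Base as ℚ using (ℚ; 0ℚ; 1ℚ; _/_; _÷_; toℚᵘ)
import Data.Rational.Properties as ℚ
open import Data.Rational.Unnormalised.Base as ℚᵘ using (mkℚᵘ; *≡*)
import Data.Rational.Unnormalised.Properties as ℚᵘ
open import Data.Sum.Base using (_⊎_; inj₁; inj₂; [_,_])
open import Data.Vec.Base as Vec using (Vec; []; _∷_; lookup; zipWith)
import Data.Vec.Functional as Vector
open import Data.Vec.Properties using (zipWith-comm; zipWith-assoc; lookup-zipWith)
open import Function.Base using (_∘_; id)
open import Function.Bundles using (mk⇔)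
open import Level using (Level; 0ℓ)
open import Relation.Binary.Construct.Closure.Equivalence as Eq using (EqClosure)
open import Relation.Binary.Core using (Rel)
import Relation.Binary.Definitions as Binary
open import Relation.Binary.PropositionalEquality
  using (_≡_; _≢_; _≗_; refl; sym; trans; cong; cong₂; subst; isEquivalence; module ≡-Reasoning)
open import Relation.Binary.Structures using (IsEquivalence)
open import Relation.Nullary using (¬_; Dec; yes; no; contradiction)
open import Relation.Nullary.Decidable
  using (¬?; does; does-⇔; dec-true; dec-false; from-yes; _×-dec_; _⊎-dec_)
open import Relation.Unary using (Pred; Decidable)
open import Relation.Unary.Properties using (∁?; _∩?_)

open AbelianGroupProperties +-0-abelianGroup using ()
  renaming (∙-cancelˡ to +-cancelˡ; ∙-cancelʳ to +-cancelʳ)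
import Algebra.Properties.CommutativeMonoid.Sum ℕ.+-0-commutativeMonoid as ℕΣ
open ≡-Reasoning

private
  variable
    ℓ ℓ′  : Level
    X Y Z : Set
    l m n : ℕ

-- That the common factor is nonzero needs an argument: `T` is not injective on antiperiodic
-- functions, since x³ + 1 = (x + 1)(x² - x + 1) and x + x² vanishes at x = -1. One application of
-- `T` lands in the part annihilated by x² - x + 1, whose roots are the primitive sixth roots of
-- unity; there x + x² = ±i√3, so T² = -3 and the values at 0 of all iterates follow from two of
-- them.
--
-- The pairs (X , Y) are labellings by ℤ₂ × ℤ₂, whereas `F G 4` is defined through residues modulo
-- 4; this is why different groups must be compared at all. Releasing constraints takes the place of
-- deletion-contraction: the vertex set stays fixed. Flows are counted for an arbitrary demand at
-- the vertices, so that fixing the value on one edge leaves a problem of the same kind. Exponents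
-- such as ∣E∣ - r(G) are never formed: the identities are multiplied out and cancelled.

⟦_⟧ : Bool → ℤ
⟦ true ⟧  = 1ℤ
⟦ false ⟧ = 0ℤ

⟦∧⟧ : ∀ x y → ⟦ x ∧ y ⟧ ≡ ⟦ x ⟧ * ⟦ y ⟧
⟦∧⟧ true  y = sym (*-identityˡ ⟦ y ⟧)
⟦∧⟧ false y = refl

⟦∨⟧ : ∀ x y → ⟦ x ∨ y ⟧ + ⟦ x ⟧ * ⟦ y ⟧ ≡ ⟦ x ⟧ + ⟦ y ⟧
⟦∨⟧ true  y = cong (1ℤ +_) (*-identityˡ ⟦ y ⟧)
⟦∨⟧ false y = trans (+-identityʳ ⟦ y ⟧) (sym (+-identityˡ ⟦ y ⟧))

-- Finite sums of integers over lists

∑ : List X → (X → ℤ) → ℤ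
∑ []       f = 0ℤ
∑ (x ∷ xs) f = f x + ∑ xs f

∑-cong-All : ∀ {xs : List X} {f g} → All (λ x → f x ≡ g x) xs → ∑ xs f ≡ ∑ xs g
∑-cong-All []       = refl
∑-cong-All (p ∷ ps) = cong₂ _+_ p (∑-cong-All ps)

∑-cong : ∀ (xs : List X) {f g} → (∀ x → f x ≡ g x) → ∑ xs f ≡ ∑ xs g
∑-cong xs f≡g = ∑-cong-All (All.universal f≡g xs)

∑-distrib-+ : ∀ (xs : List X) f g → ∑ xs (λ x → f x + g x) ≡ ∑ xs f + ∑ xs g
∑-distrib-+ []       f g = refl
∑-distrib-+ (x ∷ xs) f g =
  trans (cong (f x + g x +_) (∑-distrib-+ xs f g)) (lemma (f x) (g x) (∑ xs f) (∑ xs g))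
  where
  lemma : ∀ i j k l → i + j + (k + l) ≡ i + k + (j + l)
  lemma = solve-∀

∑-distrib-- : ∀ (xs : List X) f g → ∑ xs (λ x → f x - g x) ≡ ∑ xs f - ∑ xs g
∑-distrib-- []       f g = refl
∑-distrib-- (x ∷ xs) f g =
  trans (cong (f x - g x +_) (∑-distrib-- xs f g)) (lemma (f x) (g x) (∑ xs f) (∑ xs g))
  where
  lemma : ∀ i j k l → i - j + (k - l) ≡ i + k - (j + l)
  lemma = solve-∀

∑-distribˡ-* : ∀ (xs : List X) i f → ∑ xs (λ x → i * f x) ≡ i * ∑ xs f
∑-distribˡ-* []       i f = sym (*-zeroʳ i)
∑-distribˡ-* (x ∷ xs) i f =
  trans (cong (i * f x +_) (∑-distribˡ-* xs i f)) (sym (*-distribˡ-+ i (f x) (∑ xs f)))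

∑-distribʳ-* : ∀ (xs : List X) i f → ∑ xs (λ x → f x * i) ≡ ∑ xs f * i
∑-distribʳ-* []       i f = refl
∑-distribʳ-* (x ∷ xs) i f =
  trans (cong (f x * i +_) (∑-distribʳ-* xs i f)) (lemma (f x) (∑ xs f) i)
  where
  lemma : ∀ j k i → j * i + k * i ≡ (j + k) * i
  lemma = solve-∀

∑-zero : ∀ (xs : List X) → ∑ xs (λ _ → 0ℤ) ≡ 0ℤ
∑-zero []       = refl
∑-zero (x ∷ xs) = trans (+-identityˡ _) (∑-zero xs)

∑-const : ∀ (xs : List X) i → ∑ xs (λ _ → i) ≡ pos (length xs) * i
∑-const []       i = refl
∑-const (x ∷ xs) i = trans (cong (i +_) (∑-const xs i)) (lemma (pos (length xs)) i)
  where
  lemma : ∀ n i → i + n * i ≡ (1ℤ + n) * i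
  lemma = solve-∀

∑-swap : ∀ (xs : List X) (ys : List Y) (f : X → Y → ℤ) →
         ∑ xs (λ x → ∑ ys (f x)) ≡ ∑ ys (λ y → ∑ xs (λ x → f x y))
∑-swap []       ys f = sym (∑-zero ys)
∑-swap (x ∷ xs) ys f =
  trans (cong (∑ ys (f x) +_) (∑-swap xs ys f)) (sym (∑-distrib-+ ys (f x) _))

∑-map : ∀ (h : X → Y) xs f → ∑ (map h xs) f ≡ ∑ xs (f ∘ h)
∑-map h []       f = refl
∑-map h (x ∷ xs) f = cong (f (h x) +_) (∑-map h xs f)

∑-++ : ∀ (xs ys : List X) f → ∑ (xs ++ ys) f ≡ ∑ xs f + ∑ ys f
∑-++ []       ys f = sym (+-identityˡ _)
∑-++ (x ∷ xs) ys f =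
  trans (cong (f x +_) (∑-++ xs ys f)) (sym (+-assoc (f x) (∑ xs f) (∑ ys f)))

∑-cartesianProductWith : ∀ (h : X → Y → Z) xs ys f →
  ∑ (cartesianProductWith h xs ys) f ≡ ∑ xs (λ x → ∑ ys (λ y → f (h x y)))
∑-cartesianProductWith h []       ys f = refl
∑-cartesianProductWith h (x ∷ xs) ys f =
  trans (∑-++ (map (h x) ys) _ f)
    (cong₂ _+_ (∑-map (h x) ys f) (∑-cartesianProductWith h xs ys f))

∑-↭ : ∀ {xs ys : List X} f → xs ↭ ys → ∑ xs f ≡ ∑ ys f
∑-↭ f ↭.refl              = refl
∑-↭ f (↭.prep x p)        = cong (f x +_) (∑-↭ f p)
∑-↭ f (↭.swap {xs} x y p) = trans (lemma (f x) (f y) (∑ xs f)) (cong (λ i → f y + (f x + i)) (∑-↭ f p))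
  where
  lemma : ∀ i j k → i + (j + k) ≡ j + (i + k)
  lemma = solve-∀
∑-↭ f (↭.trans p q)       = trans (∑-↭ f p) (∑-↭ f q)

length-filter≡∑ : {P : Pred X ℓ} (P? : Decidable P) (xs : List X) →
                  pos (length (filter P? xs)) ≡ ∑ xs (λ x → ⟦ does (P? x) ⟧)
length-filter≡∑ P? []       = refl
length-filter≡∑ P? (x ∷ xs) with does (P? x)
... | true  = cong (1ℤ +_) (length-filter≡∑ P? xs)
... | false = trans (length-filter≡∑ P? xs) (sym (+-identityˡ _))

-- Counting equivalence classes

any-cong : ∀ {p q : X → Bool} (xs : List X) → (∀ x → p x ≡ q x) → any p xs ≡ any q xs
any-cong []       p≡q = refl
any-cong (x ∷ xs) p≡q = cong₂ _∨_ (p≡q x) (any-cong xs p≡q)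

any-∨ : ∀ (p q : X → Bool) xs → any (λ x → p x ∨ q x) xs ≡ any p xs ∨ any q xs
any-∨ p q []       = refl
any-∨ p q (x ∷ xs) rewrite any-∨ p q xs = lemma (p x) (q x) (any p xs) (any q xs)
  where
  lemma : ∀ i j k l → (i ∨ j) ∨ (k ∨ l) ≡ (i ∨ k) ∨ (j ∨ l)
  lemma true  j     k l = refl
  lemma false true  true  l = refl
  lemma false true  false l = refl
  lemma false false k l = refl

any-true : ∀ (p : X → Bool) {x xs} → x ∈ xs → p x ≡ true → any p xs ≡ true
any-true p (here refl) eq rewrite eq = refl
any-true p {xs = y ∷ _} (there x∈xs) eq with p y
... | true  = refl
... | false = any-true p x∈xs eq

any-false : ∀ {p : X → Bool} {xs} → All (λ x → p x ≡ false) xs → any p xs ≡ false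
any-false []                  = refl
any-false (eq ∷ eqs) rewrite eq = any-false eqs

length-filter-∁ : {P : Pred X ℓ} (P? : Decidable P) (xs : List X) →
  length (filter (¬? ∘ P?) xs) ℕ.+ length (filter P? xs) ≡ length xs
length-filter-∁ P? []       = refl
length-filter-∁ P? (x ∷ xs) with does (P? x)
... | false = cong suc (length-filter-∁ P? xs)
... | true  = trans (ℕ.+-suc _ _) (cong suc (length-filter-∁ P? xs))

filter-⊆ : {P : Pred X ℓ} {Q : Pred X ℓ′} (P? : Decidable P) (Q? : Decidable Q) →
  (∀ {x} → P x → Q x) → ∀ xs → filter P? (filter Q? xs) ≡ filter P? xs
filter-⊆ P? Q? P⊆Q []       = refl
filter-⊆ P? Q? P⊆Q (x ∷ xs) with Q? x
... | no ¬q = trans (filter-⊆ P? Q? P⊆Q xs) (sym (filter-reject P? (¬q ∘ P⊆Q)))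
... | yes _ with does (P? x)
...   | true  = cong (x ∷_) (filter-⊆ P? Q? P⊆Q xs)
...   | false = filter-⊆ P? Q? P⊆Q xs

classes : {R : Rel X ℓ} → Binary.Decidable R → List X → ℤ
classes R? xs = pos (length (deduplicate R? xs))

-- Whether the class of `x` already has a representative in `xs`, in which case prepending `x`
-- creates no new class.
hits : {R : Rel X ℓ} → Binary.Decidable R → X → List X → ℤ
hits R? x xs = ⟦ any (λ y → does (R? x y)) xs ⟧

length-deduplicate : {R : Rel X ℓ} (R? : Binary.Decidable R) (xs : List X) →
                     length (deduplicate R? xs) ℕ.≤ length xs
length-deduplicate R? []       = ℕ.z≤n
length-deduplicate R? (x ∷ xs) =
  ℕ.s≤s (ℕ.≤-trans (length-filter (¬? ∘ R? x) (deduplicate R? xs)) (length-deduplicate R? xs))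

module _ {R : Rel X ℓ} (R? : Binary.Decidable R) (isEquiv : IsEquivalence R) where

  private module R = IsEquivalence isEquiv

  -- At most one representative of each class survives: once `y` is kept, everything related to it
  -- is filtered out of the rest. If `y` is not related to `x`, that filter removes nothing related
  -- to `x`.
  filter-deduplicate : ∀ x xs → pos (length (filter (R? x) (deduplicate R? xs))) ≡ hits R? x xs
  filter-deduplicate x []       = refl
  filter-deduplicate x (y ∷ ys) with R? x y
  ... | yes xRy = cong (λ zs → pos (suc (length zs)))
        (filter-none (R? x) (All.map (λ ¬yRz xRz → ¬yRz (R.trans (R.sym xRy) xRz))
          (All.all-filter (¬? ∘ R? y) (deduplicate R? ys))))
  ... | no ¬xRy = trans
        (cong (λ zs → pos (length zs))
          (filter-⊆ (R? x) (¬? ∘ R? y) (λ xRz yRz → ¬xRy (R.trans xRz (R.sym yRz)))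
            (deduplicate R? ys)))
        (filter-deduplicate x ys)

  classes-∷ : ∀ x xs → classes R? (x ∷ xs) + hits R? x xs ≡ 1ℤ + classes R? xs
  classes-∷ x xs = begin
    classes R? (x ∷ xs) + hits R? x xs
      ≡⟨ cong (classes R? (x ∷ xs) +_) (filter-deduplicate x xs) ⟨
    pos (suc (length (filter (¬? ∘ R? x) D) ℕ.+ length (filter (R? x) D)))
      ≡⟨ cong (λ n → pos (suc n)) (length-filter-∁ (R? x) D) ⟩
    1ℤ + classes R? xs ∎
    where
    D = deduplicate R? xs

  classes-AllPairs : ∀ {xs} → AllPairs (λ x y → ¬ R x y) xs → classes R? xs ≡ pos (length xs)
  classes-AllPairs []                     = refl
  classes-AllPairs {x ∷ xs} (¬xR ∷ pairs) = begin
    classes R? (x ∷ xs)                   ≡⟨ +-identityʳ _ ⟨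
    classes R? (x ∷ xs) + 0ℤ
      ≡⟨ cong (λ p → classes R? (x ∷ xs) + ⟦ p ⟧) (any-false (All.map (dec-false (R? x _)) ¬xR)) ⟨
    classes R? (x ∷ xs) + hits R? x xs    ≡⟨ classes-∷ x xs ⟩
    1ℤ + classes R? xs                    ≡⟨ cong (1ℤ +_) (classes-AllPairs pairs) ⟩
    pos (length (x ∷ xs))                    ∎

-- The recursion `classes-∷` sees only the Boolean table of the relation.
classes-cong : {R : Rel X ℓ} (R? : Binary.Decidable R) (isEquiv : IsEquivalence R)
               {S : Rel X ℓ′} (S? : Binary.Decidable S) (isEquiv′ : IsEquivalence S) →
               (∀ x y → does (R? x y) ≡ does (S? x y)) →
               ∀ xs → classes R? xs ≡ classes S? xs
classes-cong R? eqR S? eqS R≡S []       = refl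
classes-cong R? eqR S? eqS R≡S (x ∷ xs) =
  +-cancelʳ (hits S? x xs) (classes R? (x ∷ xs)) (classes S? (x ∷ xs)) (begin
    classes R? (x ∷ xs) + hits S? x xs
      ≡⟨ cong (λ p → classes R? (x ∷ xs) + ⟦ p ⟧) (any-cong xs (R≡S x)) ⟨
    classes R? (x ∷ xs) + hits R? x xs ≡⟨ classes-∷ R? eqR x xs ⟩
    1ℤ + classes R? xs                 ≡⟨ cong (1ℤ +_) (classes-cong R? eqR S? eqS R≡S xs) ⟩
    1ℤ + classes S? xs                 ≡⟨ classes-∷ S? eqS x xs ⟨
    classes S? (x ∷ xs) + hits S? x xs ∎)

module _
  {R : Rel X ℓ} (R? : Binary.Decidable R) (isEquiv : IsEquivalence R)
  {S : Rel X ℓ′} (S? : Binary.Decidable S) (isEquiv′ : IsEquivalence S)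
  (s t : X) (¬sRt : ¬ R s t)
  (S≡ : ∀ x y → does (S? x y) ≡ (does (R? x y) ∨
          ((does (R? x s) ∧ does (R? t y)) ∨ (does (R? x t) ∧ does (R? s y)))))
  where

  private
    module R = IsEquivalence isEquiv

    meets : X → List X → Bool
    meets x = any (λ y → does (R? x y))

    same : ∀ {x y} → R x y → ∀ z → does (R? x z) ≡ does (R? y z)
    same xRy z = does-⇔ (mk⇔ (R.trans (R.sym xRy)) (R.trans xRy)) (R? _ z) (R? _ z)

    S-near-s : ∀ {x} → R s x → ¬ R t x → ∀ y → does (S? x y) ≡ does (R? s y) ∨ does (R? t y)
    S-near-s {x} sRx ¬tRx y
      rewrite S≡ x y | dec-true (R? x s) (R.sym sRx) | dec-false (R? x t) (¬tRx ∘ R.sym)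
      = cong₂ _∨_ (same (R.sym sRx) y) (Bool.∨-identityʳ _)

    S-near-t : ∀ {x} → ¬ R s x → R t x → ∀ y → does (S? x y) ≡ does (R? t y) ∨ does (R? s y)
    S-near-t {x} ¬sRx tRx y
      rewrite S≡ x y | dec-true (R? x t) (R.sym tRx) | dec-false (R? x s) (¬sRx ∘ R.sym)
      = cong (_∨ does (R? s y)) (same (R.sym tRx) y)

    S-far : ∀ {x} → ¬ R s x → ¬ R t x → ∀ y → does (S? x y) ≡ does (R? x y)
    S-far {x} ¬sRx ¬tRx y
      rewrite S≡ x y | dec-false (R? x s) (¬sRx ∘ R.sym) | dec-false (R? x t) (¬tRx ∘ R.sym)
      = Bool.∨-identityʳ _

    -- Here `u` is whichever of `s`, `t` is related to `x`, and `v` is the other. Prepending `x`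
    -- makes the class of `u` represented, so the correction `hits u * hits v` turns into `hits v`;
    -- the rest is inclusion-exclusion for being hit by `u` or by `v`. Terms to be subtracted are
    -- added on the other side and cancelled.
    add-near : ∀ {x u v xs} → R u x → (∀ y → does (S? x y) ≡ does (R? u y) ∨ does (R? v y)) →
      classes S? xs + hits R? u xs * hits R? v xs ≡ classes R? xs →
      classes S? (x ∷ xs) + hits R? v xs ≡ classes R? (x ∷ xs)
    add-near {x} {u} {v} {xs} uRx S≡u∨v merged = +-cancelʳ (a * b) _ _ (begin
      S′ + b + a * b           ≡⟨ l₁ S′ b (a * b) ⟩
      S′ + (a * b + b)         ≡⟨ +-cancelʳ a _ _ (begin
        S′ + (a * b + b) + a     ≡⟨ l₂ S′ (a * b) b a ⟩
        S′ + (a + b) + a * b     ≡⟨ cong (λ i → S′ + i + a * b) (begin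
            a + b                        ≡⟨ ⟦∨⟧ (meets u xs) (meets v xs) ⟨
            ⟦ meets u xs ∨ meets v xs ⟧ + a * b
              ≡⟨ cong (λ p → ⟦ p ⟧ + a * b) (trans (any-cong xs S≡u∨v) (any-∨ _ _ xs)) ⟨
            hits S? x xs + a * b         ∎) ⟩
        S′ + (hits S? x xs + a * b) + a * b   ≡⟨ l₃ S′ (hits S? x xs) (a * b) ⟩
        (S′ + hits S? x xs) + (a * b + a * b) ≡⟨ cong (_+ (a * b + a * b)) (classes-∷ S? isEquiv′ x xs) ⟩
        1ℤ + classes S? xs + (a * b + a * b)  ≡⟨ l₄ (classes S? xs) (a * b) ⟩
        1ℤ + (classes S? xs + a * b) + a * b  ≡⟨ cong (λ i → 1ℤ + i + a * b) merged ⟩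
        1ℤ + classes R? xs + a * b            ≡⟨ cong (_+ a * b) (classes-∷ R? isEquiv x xs) ⟨
        R′ + hits R? x xs + a * b
          ≡⟨ cong (λ p → R′ + ⟦ p ⟧ + a * b) (any-cong xs (same (R.sym uRx))) ⟩
        R′ + a + a * b                        ≡⟨ l₅ R′ a (a * b) ⟩
        R′ + a * b + a                        ∎) ⟩
      R′ + a * b               ∎)
      where
      a = hits R? u xs
      b = hits R? v xs
      S′ = classes S? (x ∷ xs)
      R′ = classes R? (x ∷ xs)
      l₁ : ∀ i j k → i + j + k ≡ i + (k + j)
      l₁ = solve-∀
      l₂ : ∀ i j k l → i + (j + k) + l ≡ i + (l + k) + j
      l₂ = solve-∀
      l₃ : ∀ i j k → i + (j + k) + k ≡ (i + j) + (k + k)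
      l₃ = solve-∀
      l₄ : ∀ i j → 1ℤ + i + (j + j) ≡ 1ℤ + (i + j) + j
      l₄ = solve-∀
      l₅ : ∀ i j k → i + j + k ≡ i + k + j
      l₅ = solve-∀

  -- For a general xs, joining the classes of s and t loses one class exactly when
  -- both are represented in xs.
  classes-merge : ∀ xs → classes S? xs + hits R? s xs * hits R? t xs ≡ classes R? xs
  classes-merge []       = refl
  classes-merge (x ∷ xs) with R? s x | R? t x
  ... | yes sRx | yes tRx = contradiction (R.trans sRx (R.sym tRx)) ¬sRt
  ... | yes sRx | no ¬tRx =
        trans (cong (classes S? (x ∷ xs) +_) (*-identityˡ (hits R? t xs)))
          (add-near {xs = xs} sRx (S-near-s sRx ¬tRx) (classes-merge xs))
  ... | no ¬sRx | yes tRx =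
        trans (cong (classes S? (x ∷ xs) +_) (*-identityʳ (hits R? s xs)))
          (add-near {xs = xs} tRx (S-near-t ¬sRx tRx)
            (trans (cong (classes S? xs +_) (*-comm (hits R? t xs) (hits R? s xs))) (classes-merge xs)))
  ... | no ¬sRx | no ¬tRx = +-cancelʳ (hits S? x xs) _ _ (begin
    S′ + ab + hits S? x xs                     ≡⟨ swapʳ S′ ab (hits S? x xs) ⟩
    S′ + hits S? x xs + ab                     ≡⟨ cong (_+ ab) (classes-∷ S? isEquiv′ x xs) ⟩
    1ℤ + classes S? xs + ab                    ≡⟨ +-assoc 1ℤ (classes S? xs) ab ⟩
    1ℤ + (classes S? xs + ab)                  ≡⟨ cong (1ℤ +_) (classes-merge xs) ⟩
    1ℤ + classes R? xs                         ≡⟨ classes-∷ R? isEquiv x xs ⟨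
    classes R? (x ∷ xs) + hits R? x xs
      ≡⟨ cong (λ p → classes R? (x ∷ xs) + ⟦ p ⟧) (any-cong xs (S-far ¬sRx ¬tRx)) ⟨
    classes R? (x ∷ xs) + hits S? x xs         ∎)
    where
    S′ = classes S? (x ∷ xs)
    ab = hits R? s xs * hits R? t xs
    swapʳ : ∀ i j k → i + j + k ≡ i + k + j
    swapʳ = solve-∀

  classes-join : ∀ {xs} → s ∈ xs → t ∈ xs → 1ℤ + classes S? xs ≡ classes R? xs
  classes-join {xs} s∈xs t∈xs = begin
    1ℤ + classes S? xs                    ≡⟨ +-comm 1ℤ (classes S? xs) ⟩
    classes S? xs + 1ℤ * 1ℤ
      ≡⟨ cong₂ (λ p q → classes S? xs + ⟦ p ⟧ * ⟦ q ⟧) (hit s∈xs) (hit t∈xs) ⟨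
    classes S? xs + hits R? s xs * hits R? t xs ≡⟨ classes-merge xs ⟩
    classes R? xs                         ∎
    where
    hit : ∀ {x} → x ∈ xs → meets x xs ≡ true
    hit x∈xs = any-true _ x∈xs (dec-true (R? _ _) R.refl)

-- Components of a graph

components : (tl hd : Fin m → Fin n) → ℕ
components {n = n} tl hd = length (deduplicate (eqClosure? tl hd) (allFin n))

components-edgeless : (tl hd : Fin 0 → Fin n) → components tl hd ≡ n
components-edgeless {n} tl hd = ℤ.+-injective (trans
  (classes-AllPairs (eqClosure? tl hd) (Eq.isEquivalence _)
    (AllPairs.map (λ x≢y → x≢y ∘ Eq.fold isEquivalence λ ()) (allFin⁺ n)))
  (cong pos (length-tabulate id)))

module _ (tl hd : Fin (suc m) → Fin n) where

  private
    tl′ = tl ∘ suc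
    hd′ = hd ∘ suc
    _~_ = EqClosure (Joined tl′ hd′)
    _~?_ = eqClosure? tl′ hd′

  components-redundant : tl zero ~ hd zero → components tl hd ≡ components tl′ hd′
  components-redundant s~t = ℤ.+-injective (classes-cong (eqClosure? tl hd) (Eq.isEquivalence _)
    _~?_ (Eq.isEquivalence _) (λ u v → does-⇔
      (mk⇔ (λ { (inj₁ u~v) → u~v
              ; (inj₂ (inj₁ (u~s , t~v))) → Eq.transitive _ u~s (Eq.transitive _ s~t t~v)
              ; (inj₂ (inj₂ (u~t , s~v))) →
                  Eq.transitive _ u~t (Eq.transitive _ (Eq.symmetric _ s~t) s~v) })
           inj₁)
      ((u ~? v) ⊎-dec (((u ~? tl zero) ×-dec (hd zero ~? v)) ⊎-dec
                       ((u ~? hd zero) ×-dec (tl zero ~? v))))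
      (u ~? v)) (allFin n))

  components-bridge : ¬ tl zero ~ hd zero → suc (components tl hd) ≡ components tl′ hd′
  components-bridge s≁t = ℤ.+-injective (classes-join _~?_ (Eq.isEquivalence _)
    -- With at least one edge, `eqClosure?` computes to exactly the disjunction that `classes-join`
    -- asks for, hence `refl`.
    (eqClosure? tl hd) (Eq.isEquivalence _) (tl zero) (hd zero) s≁t (λ u v → refl)
    (∈-allFin (tl zero)) (∈-allFin (hd zero)))

-- Flows with values in a finite abelian group

-- Listing `ε` first makes every sum over `elements` split definitionally into the zero value and
-- the nonzero ones, and makes `order` a successor.
record FiniteAbelianGroup : Set₁ where
  infixl 7 _∙_
  infix  8 _⁻¹
  field
    Carrier        : Set
    _∙_            : Carrier → Carrier → Carrier
    ε              : Carrier
    _⁻¹            : Carrier → Carrier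
    isAbelianGroup : IsAbelianGroup _≡_ _∙_ ε _⁻¹
    _≟_            : Binary.DecidableEquality Carrier
    others         : List Carrier

  elements : List Carrier
  elements = ε ∷ others

  field
    unique   : Unique elements
    complete : ∀ g → g ∈ elements

  abelianGroup : AbelianGroup 0ℓ 0ℓ
  abelianGroup = record { isAbelianGroup = isAbelianGroup }

  open IsAbelianGroup isAbelianGroup public
    using (identityˡ; identityʳ; inverseˡ; inverseʳ; assoc; comm)
  open AbelianGroupProperties abelianGroup public
    using (∙-cancelˡ; ∙-cancelʳ; ε⁻¹≈ε; ⁻¹-∙-comm; ⁻¹-involutive)
  open CommutativeMonoidSum (AbelianGroup.commutativeMonoid abelianGroup) public
    using (sum; sum-cong-≗; sum-replicate-zero) renaming (∑-distrib-+ to sum-∙)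

  others≢ε : All (_≢ ε) others
  others≢ε with ε≢ ∷ _ ← unique = All.map (λ ε≢g g≡ε → ε≢g (sym g≡ε)) ε≢

  order : ℤ
  order = pos (length elements)

  ∙-interchange : ∀ x y z w → (x ∙ y) ∙ (z ∙ w) ≡ (x ∙ z) ∙ (y ∙ w)
  ∙-interchange x y z w = begin
    (x ∙ y) ∙ (z ∙ w) ≡⟨ assoc x y (z ∙ w) ⟩
    x ∙ (y ∙ (z ∙ w)) ≡⟨ cong (x ∙_) (assoc y z w) ⟨
    x ∙ (y ∙ z ∙ w)   ≡⟨ cong (λ g → x ∙ (g ∙ w)) (comm y z) ⟩
    x ∙ (z ∙ y ∙ w)   ≡⟨ cong (x ∙_) (assoc z y w) ⟩
    x ∙ (z ∙ (y ∙ w)) ≡⟨ assoc x z (y ∙ w) ⟨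
    (x ∙ z) ∙ (y ∙ w) ∎

  -- Both lists are free of repetitions and have the same members, so they are permutations of each
  -- other.
  translate : ∀ g → map (g ∙_) elements ↭ elements
  translate g = ∼bag⇒↭ (unique∧set⇒bag (map⁺ (∙-cancelˡ g _ _) unique) unique
    λ {h} → mk⇔ (λ _ → complete h)
                (λ _ → subst (_∈ map (g ∙_) elements) (gg⁻¹ h) (∈-map⁺ (g ∙_) (complete (g ⁻¹ ∙ h)))))
    where
    gg⁻¹ : ∀ h → g ∙ (g ⁻¹ ∙ h) ≡ h
    gg⁻¹ h = trans (sym (assoc g (g ⁻¹) h)) (trans (cong (_∙ h) (inverseʳ g)) (identityˡ h))

  ∑-translate : ∀ f g → ∑ elements (λ h → f (g ∙ h)) ≡ ∑ elements f
  ∑-translate f g = trans (sym (∑-map (g ∙_) elements f)) (∑-↭ f (translate g))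

module Flow (Γ : FiniteAbelianGroup) where
  open FiniteAbelianGroup Γ public

  Demand : ℕ → Set
  Demand n = Fin n → Carrier

  infixl 6 _⊕_
  _⊕_ : Demand n → Demand n → Demand n
  (d ⊕ d′) v = d v ∙ d′ v

  𝟘 : Demand n
  𝟘 _ = ε

  _at_ : Carrier → Fin n → Demand n
  (g at s) v = if does (s Fin.≟ v) then g else ε

  -- The net outflow caused by sending g along an edge from s to t.
  ∂ : (s t : Fin n) → Carrier → Demand n
  ∂ s t g v = (g at s) v ∙ (g at t) v ⁻¹

  at-∙ : ∀ (s : Fin n) g h v → ((g ∙ h) at s) v ≡ (g at s) v ∙ (h at s) v
  at-∙ s g h v with does (s Fin.≟ v)
  ... | true  = refl
  ... | false = sym (identityˡ ε)

  at-ε : ∀ (s : Fin n) v → (ε at s) v ≡ ε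
  at-ε s v with does (s Fin.≟ v)
  ... | true  = refl
  ... | false = refl

  at-⁻¹ : ∀ (s : Fin n) g v → ((g ⁻¹) at s) v ≡ (g at s) v ⁻¹
  at-⁻¹ s g v with does (s Fin.≟ v)
  ... | true  = refl
  ... | false = sym ε⁻¹≈ε

  ∂-∙ : ∀ (s t : Fin n) g h v → ∂ s t (g ∙ h) v ≡ ∂ s t g v ∙ ∂ s t h v
  ∂-∙ s t g h v = begin
    ((g ∙ h) at s) v ∙ ((g ∙ h) at t) v ⁻¹
      ≡⟨ cong₂ (λ x y → x ∙ y ⁻¹) (at-∙ s g h v) (at-∙ t g h v) ⟩
    (g at s) v ∙ (h at s) v ∙ ((g at t) v ∙ (h at t) v) ⁻¹
      ≡⟨ cong ((g at s) v ∙ (h at s) v ∙_) (⁻¹-∙-comm _ _) ⟨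
    (g at s) v ∙ (h at s) v ∙ ((g at t) v ⁻¹ ∙ (h at t) v ⁻¹)
      ≡⟨ ∙-interchange _ _ _ _ ⟩
    ∂ s t g v ∙ ∂ s t h v ∎

  ∂-ε : ∀ (s t : Fin n) v → ∂ s t ε v ≡ ε
  ∂-ε s t v = begin
    (ε at s) v ∙ (ε at t) v ⁻¹ ≡⟨ cong₂ (λ x y → x ∙ y ⁻¹) (at-ε s v) (at-ε t v) ⟩
    ε ∙ ε ⁻¹                   ≡⟨ inverseʳ ε ⟩
    ε                          ∎

  ∂-loop : ∀ (s : Fin n) g v → ∂ s s g v ≡ ε
  ∂-loop s g v = inverseʳ _

  ∂-reverse : ∀ (s t : Fin n) g v → ∂ t s g v ≡ ∂ s t (g ⁻¹) v
  ∂-reverse s t g v = begin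
    (g at t) v ∙ (g at s) v ⁻¹           ≡⟨ comm _ _ ⟩
    (g at s) v ⁻¹ ∙ (g at t) v           ≡⟨ cong ((g at s) v ⁻¹ ∙_) (⁻¹-involutive _) ⟨
    (g at s) v ⁻¹ ∙ (g at t) v ⁻¹ ⁻¹     ≡⟨ cong₂ (λ x y → x ∙ y ⁻¹) (at-⁻¹ s g v) (at-⁻¹ t g v) ⟨
    ∂ s t (g ⁻¹) v                       ∎

  ∂-path : ∀ (s t u : Fin n) g v → ∂ s t g v ∙ ∂ t u g v ≡ ∂ s u g v
  ∂-path s t u g v = begin
    x ∙ y ⁻¹ ∙ (y ∙ z ⁻¹)   ≡⟨ assoc x (y ⁻¹) (y ∙ z ⁻¹) ⟩
    x ∙ (y ⁻¹ ∙ (y ∙ z ⁻¹)) ≡⟨ cong (x ∙_) (assoc (y ⁻¹) y (z ⁻¹)) ⟨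
    x ∙ (y ⁻¹ ∙ y ∙ z ⁻¹)   ≡⟨ cong (λ e → x ∙ (e ∙ z ⁻¹)) (inverseˡ y) ⟩
    x ∙ (ε ∙ z ⁻¹)          ≡⟨ cong (x ∙_) (identityˡ (z ⁻¹)) ⟩
    x ∙ z ⁻¹                ∎
    where
    x = (g at s) v
    y = (g at t) v
    z = (g at u) v

  Extensional : (Demand n → ℤ) → Set
  Extensional c = ∀ {d d′} → (∀ v → d v ≡ d′ v) → c d ≡ c d′

  -- Sums c over the demands d + ∂f, for all f with values in gs.
  extend : List Carrier → (tl hd : Fin m → Fin n) → (Demand n → ℤ) → Demand n → ℤ
  extend {zero}  gs tl hd c d = c d
  extend {suc m} gs tl hd c d =
    ∑ gs λ g → extend gs (tl ∘ suc) (hd ∘ suc) c (d ⊕ ∂ (tl zero) (hd zero) g)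

  extend-ext : ∀ gs (tl hd : Fin m → Fin n) {c} → Extensional c → Extensional (extend gs tl hd c)
  extend-ext {zero}  gs tl hd c-ext d≡d′ = c-ext d≡d′
  extend-ext {suc m} gs tl hd c-ext d≡d′ = ∑-cong gs λ g →
    extend-ext gs (tl ∘ suc) (hd ∘ suc) c-ext λ v → cong (_∙ _) (d≡d′ v)

  ⊕-swap : ∀ (d d₁ d₂ : Demand n) v → (d ⊕ d₁ ⊕ d₂) v ≡ (d ⊕ d₂ ⊕ d₁) v
  ⊕-swap d d₁ d₂ v = begin
    d v ∙ d₁ v ∙ d₂ v   ≡⟨ assoc (d v) (d₁ v) (d₂ v) ⟩
    d v ∙ (d₁ v ∙ d₂ v) ≡⟨ cong (d v ∙_) (comm (d₁ v) (d₂ v)) ⟩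
    d v ∙ (d₂ v ∙ d₁ v) ≡⟨ assoc (d v) (d₂ v) (d₁ v) ⟨
    d v ∙ d₂ v ∙ d₁ v   ∎

  -- Lets an edge that is summed innermost, inside the weight, be treated as if it were the first
  -- one.
  extend-∑ : ∀ gs (tl hd : Fin m → Fin n) {c} → Extensional c → ∀ hs (δ : Carrier → Demand n) d →
    extend gs tl hd (λ d → ∑ hs λ h → c (d ⊕ δ h)) d ≡ ∑ hs λ h → extend gs tl hd c (d ⊕ δ h)
  extend-∑ {zero}  gs tl hd c-ext hs δ d = refl
  extend-∑ {suc m} gs tl hd {c} c-ext hs δ d = begin
    (∑ gs λ g → extend gs tl′ hd′ (λ d → ∑ hs λ h → c (d ⊕ δ h)) (d ⊕ ∂₀ g))
      ≡⟨ ∑-cong gs (λ g → extend-∑ gs tl′ hd′ c-ext hs δ (d ⊕ ∂₀ g)) ⟩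
    (∑ gs λ g → ∑ hs λ h → extend gs tl′ hd′ c (d ⊕ ∂₀ g ⊕ δ h))
      ≡⟨ ∑-swap gs hs _ ⟩
    (∑ hs λ h → ∑ gs λ g → extend gs tl′ hd′ c (d ⊕ ∂₀ g ⊕ δ h))
      ≡⟨ ∑-cong hs (λ h → ∑-cong gs λ g →
           extend-ext gs tl′ hd′ c-ext (⊕-swap d (∂₀ g) (δ h))) ⟩
    (∑ hs λ h → ∑ gs λ g → extend gs tl′ hd′ c (d ⊕ δ h ⊕ ∂₀ g)) ∎
    where
    tl′ = tl ∘ suc
    hd′ = hd ∘ suc
    ∂₀ = ∂ (tl zero) (hd zero)

  zero? : (d : Demand n) → Dec (∀ v → d v ≡ ε)
  zero? d = all? λ v → d v ≟ ε

  balanced : Demand n → ℤ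
  balanced d = ⟦ does (zero? d) ⟧

  balanced-ext : Extensional (balanced {n})
  balanced-ext {d = d} {d′} d≡d′ = cong ⟦_⟧ (does-⇔
    (mk⇔ (λ d≡ε v → trans (sym (d≡d′ v)) (d≡ε v)) (λ d′≡ε v → trans (d≡d′ v) (d′≡ε v)))
    (zero? d) (zero? d′))

  flows : (tl hd : Fin m → Fin n) → Demand n → ℤ
  flows tl hd = extend elements tl hd balanced

  flows-ext : (tl hd : Fin m → Fin n) → Extensional (flows tl hd)
  flows-ext tl hd = extend-ext elements tl hd balanced-ext

  -- The extra demand is absorbed by translating the value on the edge `e` itself.
  flows-shift-edge : (tl hd : Fin m → Fin n) → ∀ e g d →
                     flows tl hd (d ⊕ ∂ (tl e) (hd e) g) ≡ flows tl hd d
  flows-shift-edge {suc m} tl hd zero g d = begin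
    (∑ elements λ h → flows tl′ hd′ (d ⊕ ∂₀ g ⊕ ∂₀ h))
      ≡⟨ ∑-cong elements (λ h → flows-ext tl′ hd′ λ v →
           trans (assoc (d v) (∂₀ g v) (∂₀ h v)) (cong (d v ∙_) (sym (∂-∙ (tl zero) (hd zero) g h v)))) ⟩
    (∑ elements λ h → flows tl′ hd′ (d ⊕ ∂₀ (g ∙ h)))
      ≡⟨ ∑-translate (λ h → flows tl′ hd′ (d ⊕ ∂₀ h)) g ⟩
    (∑ elements λ h → flows tl′ hd′ (d ⊕ ∂₀ h)) ∎
    where
    tl′ = tl ∘ suc
    hd′ = hd ∘ suc
    ∂₀ = ∂ (tl zero) (hd zero)
  flows-shift-edge {suc m} tl hd (suc e) g d = ∑-cong elements λ h → trans
    (flows-ext (tl ∘ suc) (hd ∘ suc) (⊕-swap d (∂ (tl (suc e)) (hd (suc e)) g) _))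
    (flows-shift-edge (tl ∘ suc) (hd ∘ suc) e g _)

  -- The pairs `s`, `t` with this invariance for all `g` and `d` form an equivalence relation that
  -- contains the edges, hence contains connectedness. Quantifying over `g` is what gives symmetry:
  -- reversal replaces `g` by its inverse.
  flows-shift : (tl hd : Fin m → Fin n) → ∀ {s t} → EqClosure (Joined tl hd) s t →
                ∀ g d → flows tl hd (d ⊕ ∂ s t g) ≡ flows tl hd d
  flows-shift tl hd = Eq.fold
    {S = λ s t → ∀ g d → flows tl hd (d ⊕ ∂ s t g) ≡ flows tl hd d}
    (record
      { refl  = λ {s} g d → flows-ext tl hd λ v →
          trans (cong (d v ∙_) (∂-loop s g v)) (identityʳ (d v))
      ; sym   = λ {s} {t} shift g d → trans
          (flows-ext tl hd λ v → cong (d v ∙_) (∂-reverse s t g v)) (shift (g ⁻¹) d)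
      ; trans = λ {s} {t} {u} shift₁ shift₂ g d → trans
          (flows-ext tl hd λ v → trans (cong (d v ∙_) (sym (∂-path s t u g v))) (sym (assoc _ _ _)))
          (trans (shift₂ g _) (shift₁ g d))
      })
    λ { (e , refl , refl) → flows-shift-edge tl hd e }

  module _ (χ : Fin n → Bool) where

    total : Demand n → Carrier
    total d = sum λ v → if χ v then d v else ε

    total-⊕ : ∀ d d′ → total (d ⊕ d′) ≡ total d ∙ total d′
    total-⊕ d d′ = trans (sum-cong-≗ split)
      (sum-∙ (λ v → if χ v then d v else ε) (λ v → if χ v then d′ v else ε))
      where
      split : ∀ v → (if χ v then d v ∙ d′ v else ε) ≡
                    (if χ v then d v else ε) ∙ (if χ v then d′ v else ε)
      split v with χ v
      ... | true  = refl
      ... | false = sym (identityˡ ε)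

    total-𝟘 : ∀ {d} → (∀ v → d v ≡ ε) → total d ≡ ε
    total-𝟘 {d} d≡ε = trans (sum-cong-≗ lemma) (sum-replicate-zero n)
      where
      lemma : ∀ v → (if χ v then d v else ε) ≡ ε
      lemma v with χ v
      ... | true  = d≡ε v
      ... | false = refl

  sum-at : ∀ (s : Fin n) (x : Fin n → Carrier) →
           (sum λ v → if does (s Fin.≟ v) then x v else ε) ≡ x s
  sum-at {suc n} zero    x = trans (cong (x zero ∙_) (sum-replicate-zero n)) (identityʳ _)
  sum-at {suc n} (suc s) x = trans (identityˡ _) (sum-at s (x ∘ suc))

  total-at : ∀ (χ : Fin n → Bool) g s → total χ (g at s) ≡ (if χ s then g else ε)
  total-at χ g s = trans (sum-cong-≗ lemma) (sum-at s λ v → if χ v then g else ε)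
    where
    lemma : ∀ v → (if χ v then (if does (s Fin.≟ v) then g else ε) else ε) ≡
                  (if does (s Fin.≟ v) then (if χ v then g else ε) else ε)
    lemma v with χ v | does (s Fin.≟ v)
    ... | true  | _     = refl
    ... | false | true  = refl
    ... | false | false = refl

  -- Adding `g at t` undoes the inverse in `∂ s t g`, which avoids separating the four cases of `s`
  -- and `t` inside or outside `χ`.
  total-∂ : ∀ (χ : Fin n → Bool) s t g →
            total χ (∂ s t g) ∙ (if χ t then g else ε) ≡ (if χ s then g else ε)
  total-∂ χ s t g = begin
    total χ (∂ s t g) ∙ (if χ t then g else ε) ≡⟨ cong (total χ (∂ s t g) ∙_) (total-at χ g t) ⟨
    total χ (∂ s t g) ∙ total χ (g at t)       ≡⟨ total-⊕ χ (∂ s t g) (g at t) ⟨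
    total χ (∂ s t g ⊕ (g at t))               ≡⟨ sum-cong-≗ (λ v → cong (if χ v then_else ε) (begin
        (g at s) v ∙ (g at t) v ⁻¹ ∙ (g at t) v   ≡⟨ assoc _ _ _ ⟩
        (g at s) v ∙ ((g at t) v ⁻¹ ∙ (g at t) v) ≡⟨ cong ((g at s) v ∙_) (inverseˡ _) ⟩
        (g at s) v ∙ ε                            ≡⟨ identityʳ _ ⟩
        (g at s) v                                ∎)) ⟩
    total χ (g at s)                           ≡⟨ total-at χ g s ⟩
    (if χ s then g else ε)                     ∎

  -- A boundary sums to ε over every union χ of components.
  flows-unbalanced : (tl hd : Fin m → Fin n) (χ : Fin n → Bool) → (∀ e → χ (tl e) ≡ χ (hd e)) →
                     ∀ d → total χ d ≢ ε → flows tl hd d ≡ 0ℤ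
  flows-unbalanced {zero}  tl hd χ χ-inv d total≢ε =
    cong ⟦_⟧ (dec-false (zero? d) (total≢ε ∘ total-𝟘 χ))
  flows-unbalanced {suc m} tl hd χ χ-inv d total≢ε = trans
    (∑-cong elements λ g → flows-unbalanced (tl ∘ suc) (hd ∘ suc) χ (χ-inv ∘ suc) _
      λ total≡ε → total≢ε (begin
        total χ d             ≡⟨ identityʳ _ ⟨
        total χ d ∙ ε         ≡⟨ cong (total χ d ∙_) (total-∂₀ g) ⟨
        total χ d ∙ total χ (∂₀ g) ≡⟨ total-⊕ χ d (∂₀ g) ⟨
        total χ (d ⊕ ∂₀ g)    ≡⟨ total≡ε ⟩
        ε                     ∎))
    (∑-zero elements)
    where
    ∂₀ = ∂ (tl zero) (hd zero)
    total-∂₀ : ∀ g → total χ (∂₀ g) ≡ ε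
    total-∂₀ g = identityˡ-unique _ _
      (trans (total-∂ χ _ _ g) (cong (if_then g else ε) (χ-inv zero)))
      where open AbelianGroupProperties abelianGroup using (identityˡ-unique)

  -- Whatever value the new edge carries can be rerouted along a path of old edges, so every value
  -- contributes equally.
  flows-redundant : (tl hd : Fin (suc m) → Fin n) →
                    EqClosure (Joined (tl ∘ suc) (hd ∘ suc)) (tl zero) (hd zero) →
                    ∀ d → flows tl hd d ≡ order * flows (tl ∘ suc) (hd ∘ suc) d
  flows-redundant tl hd s~t d = trans
    (∑-cong elements λ g → flows-shift (tl ∘ suc) (hd ∘ suc) s~t g d)
    (∑-const elements _)

  -- Take `χ` to be the component of `s` without the new edge. A value `g` on that edge leaves the
  -- total `g` on `χ`, which the old edges cannot compensate unless `g` is `ε`. Demand `𝟘` is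
  -- essential: another demand could force a different value across the bridge.
  flows-bridge : (tl hd : Fin (suc m) → Fin n) →
                 ¬ EqClosure (Joined (tl ∘ suc) (hd ∘ suc)) (tl zero) (hd zero) →
                 flows tl hd 𝟘 ≡ flows (tl ∘ suc) (hd ∘ suc) 𝟘
  flows-bridge {n = n} tl hd s≁t = begin
    flows tl′ hd′ (𝟘 ⊕ ∂ s t ε) + ∑ others (λ g → flows tl′ hd′ (𝟘 ⊕ ∂ s t g))
      ≡⟨ cong₂ _+_
           (flows-ext tl′ hd′ λ v → trans (identityˡ _) (∂-ε s t v))
           (trans (∑-cong-All (All.map unbalanced others≢ε)) (∑-zero others)) ⟩
    flows tl′ hd′ 𝟘 + 0ℤ ≡⟨ +-identityʳ _ ⟩
    flows tl′ hd′ 𝟘      ∎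
    where
    tl′ = tl ∘ suc
    hd′ = hd ∘ suc
    s = tl zero
    t = hd zero

    χ : Fin n → Bool
    χ v = does (eqClosure? tl′ hd′ s v)

    χ-invariant : ∀ e → χ (tl′ e) ≡ χ (hd′ e)
    χ-invariant e = does-⇔
      (mk⇔ (λ s~u → Eq.transitive _ s~u u~v) (λ s~v → Eq.transitive _ s~v (Eq.symmetric _ u~v)))
      (eqClosure? tl′ hd′ s (tl′ e)) (eqClosure? tl′ hd′ s (hd′ e))
      where
      u~v : EqClosure (Joined tl′ hd′) (tl′ e) (hd′ e)
      u~v = Eq.return (e , refl , refl)

    total-∂ₛₜ : ∀ g → total χ (∂ s t g) ≡ g
    total-∂ₛₜ g = begin
      total χ (∂ s t g)                          ≡⟨ identityʳ _ ⟨
      total χ (∂ s t g) ∙ (if false then g else ε)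
        ≡⟨ cong (λ b → total χ (∂ s t g) ∙ (if b then g else ε))
             (dec-false (eqClosure? tl′ hd′ s t) s≁t) ⟨
      total χ (∂ s t g) ∙ (if χ t then g else ε) ≡⟨ total-∂ χ s t g ⟩
      (if χ s then g else ε)
        ≡⟨ cong (if_then g else ε) (dec-true (eqClosure? tl′ hd′ s s) (Eq.reflexive _)) ⟩
      g                                          ∎

    unbalanced : ∀ {g} → g ≢ ε → flows tl′ hd′ (𝟘 ⊕ ∂ s t g) ≡ 0ℤ
    unbalanced {g} g≢ε = flows-unbalanced tl′ hd′ χ χ-invariant _ λ total≡ε →
      g≢ε (trans (sym (total-∂ₛₜ g)) (trans (sym (sum-cong-≗ λ v →
        cong (if χ v then_else ε) (identityˡ _))) total≡ε))

  -- The count is `order` to the cyclomatic number `m − n + components tl hd`, here cleared of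
  -- differences in the exponent. A redundant edge raises this number by one; a bridge also lowers
  -- the number of components and leaves it unchanged.
  flows-count : (tl hd : Fin m → Fin n) →
                flows tl hd 𝟘 * order ^ n ≡ order ^ m * order ^ components tl hd
  flows-count {zero} {n} tl hd = cong₂ (λ i k → i * order ^ k)
    (cong ⟦_⟧ (dec-true (zero? (𝟘 {n})) λ v → refl)) (sym (components-edgeless tl hd))
  flows-count {suc m} {n} tl hd with eqClosure? (tl ∘ suc) (hd ∘ suc) (tl zero) (hd zero)
  ... | yes s~t = begin
    flows tl hd 𝟘 * order ^ n                 ≡⟨ cong (_* order ^ n) (flows-redundant tl hd s~t 𝟘) ⟩
    order * flows tl′ hd′ 𝟘 * order ^ n       ≡⟨ *-assoc order (flows tl′ hd′ 𝟘) (order ^ n) ⟩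
    order * (flows tl′ hd′ 𝟘 * order ^ n)     ≡⟨ cong (order *_) (flows-count tl′ hd′) ⟩
    order * (order ^ m * order ^ components tl′ hd′)
      ≡⟨ *-assoc order (order ^ m) (order ^ components tl′ hd′) ⟨
    order ^ suc m * order ^ components tl′ hd′
      ≡⟨ cong (λ k → order ^ suc m * order ^ k) (components-redundant tl hd s~t) ⟨
    order ^ suc m * order ^ components tl hd  ∎
    where
    tl′ = tl ∘ suc
    hd′ = hd ∘ suc
  ... | no s≁t = begin
    flows tl hd 𝟘 * order ^ n                 ≡⟨ cong (_* order ^ n) (flows-bridge tl hd s≁t) ⟩
    flows tl′ hd′ 𝟘 * order ^ n               ≡⟨ flows-count tl′ hd′ ⟩
    order ^ m * order ^ components tl′ hd′
      ≡⟨ cong (λ k → order ^ m * order ^ k) (components-bridge tl hd s≁t) ⟨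
    order ^ m * (order * order ^ components tl hd)
      ≡⟨ lemma (order ^ m) order (order ^ components tl hd) ⟩
    order ^ suc m * order ^ components tl hd  ∎
    where
    tl′ = tl ∘ suc
    hd′ = hd ∘ suc
    lemma : ∀ i j k → i * (j * k) ≡ j * i * k
    lemma = solve-∀

  -- The edges of tl₁, hd₁ carry arbitrary values, those of tl₂, hd₂ nonzero ones.
  mixedFlows : (tl₁ hd₁ : Fin l → Fin n) (tl₂ hd₂ : Fin m → Fin n) → ℤ
  mixedFlows tl₁ hd₁ tl₂ hd₂ = extend others tl₂ hd₂ (flows tl₁ hd₁) 𝟘

  -- A free edge either carries 0, and may be deleted, or carries a nonzero value.
  mixedFlows-release : (tl₁ hd₁ : Fin l → Fin n) (tl₂ hd₂ : Fin (suc m) → Fin n) →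
    mixedFlows (tl₂ zero Vector.∷ tl₁) (hd₂ zero Vector.∷ hd₁) (tl₂ ∘ suc) (hd₂ ∘ suc) ≡
    mixedFlows tl₁ hd₁ (tl₂ ∘ suc) (hd₂ ∘ suc) + mixedFlows tl₁ hd₁ tl₂ hd₂
  mixedFlows-release tl₁ hd₁ tl₂ hd₂ = begin
    extend others tl₂′ hd₂′ (λ d → ∑ elements λ h → flows tl₁ hd₁ (d ⊕ ∂ s t h)) 𝟘
      ≡⟨ extend-∑ others tl₂′ hd₂′ (flows-ext tl₁ hd₁) elements (∂ s t) 𝟘 ⟩
    (∑ elements λ h → extend others tl₂′ hd₂′ (flows tl₁ hd₁) (𝟘 ⊕ ∂ s t h))
      -- The part of the sum over `others` is definitionally `mixedFlows tl₁ hd₁ tl₂ hd₂`; only the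
      -- term for `ε` has to be rewritten.
      ≡⟨ cong (_+ mixedFlows tl₁ hd₁ tl₂ hd₂)
           (extend-ext others tl₂′ hd₂′ (flows-ext tl₁ hd₁) λ v → trans (identityˡ _) (∂-ε s t v)) ⟩
    mixedFlows tl₁ hd₁ tl₂′ hd₂′ + mixedFlows tl₁ hd₁ tl₂ hd₂ ∎
    where
    tl₂′ = tl₂ ∘ suc
    hd₂′ = hd₂ ∘ suc
    s = tl₂ zero
    t = hd₂ zero

  -- Flow counts as sums over edge labellings

  boundary : (tl hd : Fin m → Fin n) → Vec Carrier m → Demand n
  boundary tl hd f v = sum λ e → ∂ (tl e) (hd e) (lookup f e) v

  extend-vectors : ∀ gs (tl hd : Fin m → Fin n) {c} → Extensional c → ∀ d →
    extend gs tl hd c d ≡ ∑ (vectors gs m) λ f → c (d ⊕ boundary tl hd f)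
  extend-vectors {zero}  gs tl hd {c} c-ext d = sym (trans (+-identityʳ _) (c-ext λ v → identityʳ (d v)))
  extend-vectors {suc m} gs tl hd {c} c-ext d = begin
    (∑ gs λ g → extend gs tl′ hd′ c (d ⊕ ∂₀ g))
      ≡⟨ ∑-cong gs (λ g → extend-vectors gs tl′ hd′ c-ext (d ⊕ ∂₀ g)) ⟩
    (∑ gs λ g → ∑ (vectors gs m) λ f → c (d ⊕ ∂₀ g ⊕ boundary tl′ hd′ f))
      ≡⟨ ∑-cong gs (λ g → ∑-cong (vectors gs m) λ f → c-ext λ v → assoc (d v) (∂₀ g v) _) ⟩
    (∑ gs λ g → ∑ (vectors gs m) λ f → c (d ⊕ boundary tl hd (g ∷ f)))
      ≡⟨ ∑-cartesianProductWith _∷_ gs (vectors gs m) _ ⟨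
    (∑ (vectors gs (suc m)) λ f → c (d ⊕ boundary tl hd f)) ∎
    where
    tl′ = tl ∘ suc
    hd′ = hd ∘ suc
    ∂₀ = ∂ (tl zero) (hd zero)

  nowhereZero? : (f : Vec Carrier m) → Dec (∀ e → lookup f e ≢ ε)
  nowhereZero? f = all? λ e → ¬? (lookup f e ≟ ε)

  nowhereZero?-∷ : ∀ g (f : Vec Carrier m) →
    does (nowhereZero? (g ∷ f)) ≡ does (¬? (g ≟ ε)) ∧ does (nowhereZero? f)
  nowhereZero?-∷ g f = does-⇔
    (mk⇔ (λ nz → nz zero , nz ∘ suc) (λ (g≢ε , nz) → ∀-cons g≢ε nz))
    (nowhereZero? (g ∷ f)) (¬? (g ≟ ε) ×-dec nowhereZero? f)

  -- Reconciles two ways of imposing the constraint: `F` filters all labellings, `mixedFlows` ranges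
  -- over nonzero values only.
  ∑-nowhereZero : ∀ m (c : Vec Carrier m → ℤ) →
    (∑ (vectors elements m) λ f → ⟦ does (nowhereZero? f) ⟧ * c f) ≡ ∑ (vectors others m) c
  ∑-nowhereZero zero    c = cong (_+ 0ℤ) (*-identityˡ (c []))
  ∑-nowhereZero (suc m) c = begin
    (∑ (vectors elements (suc m)) λ f → ⟦ does (nowhereZero? f) ⟧ * c f)
      ≡⟨ ∑-cartesianProductWith _∷_ elements (vectors elements m) _ ⟩
    (∑ elements λ g → ∑ (vectors elements m) λ f → ⟦ does (nowhereZero? (g ∷ f)) ⟧ * c (g ∷ f))
      ≡⟨ cong₂ _+_
           (trans (∑-cong (vectors elements m) λ f → cong (_* c (ε ∷ f))
                     (trans (cong ⟦_⟧ (nowhereZero?-∷ ε f))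
                            (cong (λ b → ⟦ b ∧ does (nowhereZero? f) ⟧)
                              (dec-false (¬? (ε ≟ ε)) λ ε≢ε → ε≢ε refl))))
                  (∑-zero (vectors elements m)))
           (∑-cong-All (All.map (λ {g} g≢ε → trans
             (∑-cong (vectors elements m) λ f → cong (_* c (g ∷ f))
               (cong ⟦_⟧ (trans (nowhereZero?-∷ g f) (cong (_∧ _) (dec-true (¬? (g ≟ ε)) g≢ε)))))
             (∑-nowhereZero m (c ∘ (g ∷_)))) others≢ε)) ⟩
    0ℤ + (∑ others λ g → ∑ (vectors others m) λ f → c (g ∷ f))
      ≡⟨ +-identityˡ _ ⟩
    (∑ others λ g → ∑ (vectors others m) λ f → c (g ∷ f))
      ≡⟨ ∑-cartesianProductWith _∷_ others (vectors others m) c ⟨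
    ∑ (vectors others (suc m)) c ∎

  flows≡∑ : (tl hd : Fin m → Fin n) →
    flows tl hd 𝟘 ≡ ∑ (vectors elements m) λ f → balanced (boundary tl hd f)
  flows≡∑ {m} tl hd = trans (extend-vectors elements tl hd balanced-ext 𝟘)
    (∑-cong (vectors elements m) λ f → balanced-ext {d′ = boundary tl hd f} λ v → identityˡ _)

  nowhereZeroFlows : (tl hd : Fin m → Fin n) → ℤ
  nowhereZeroFlows = mixedFlows {l = 0} (λ ()) (λ ())

  nowhereZeroFlows≡∑ : (tl hd : Fin m → Fin n) → nowhereZeroFlows tl hd ≡
    ∑ (vectors elements m) λ f → ⟦ does (nowhereZero? f) ⟧ * balanced (boundary tl hd f)
  nowhereZeroFlows≡∑ {m} tl hd = begin
    nowhereZeroFlows tl hd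
      ≡⟨ extend-vectors others tl hd (flows-ext {0} (λ ()) (λ ())) 𝟘 ⟩
    (∑ (vectors others m) λ f → balanced (𝟘 ⊕ boundary tl hd f))
      ≡⟨ ∑-cong (vectors others m) (λ f → balanced-ext {d′ = boundary tl hd f} λ v → identityˡ _) ⟩
    (∑ (vectors others m) λ f → balanced (boundary tl hd f))
      ≡⟨ ∑-nowhereZero m _ ⟨
    (∑ (vectors elements m) λ f → ⟦ does (nowhereZero? f) ⟧ * balanced (boundary tl hd f)) ∎

-- Flow counts depend only on the order of the group

module _ (Γ₁ Γ₂ : FiniteAbelianGroup) where

  private
    module Γ₁ = Flow Γ₁
    module Γ₂ = Flow Γ₂

  module _ (order≡ : Γ₁.order ≡ Γ₂.order) where

    flows-order : (tl hd : Fin m → Fin n) → Γ₁.flows tl hd Γ₁.𝟘 ≡ Γ₂.flows tl hd Γ₂.𝟘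
    flows-order {m} {n} tl hd = *-cancelʳ-≡ _ _ (Γ₁.order ^ n) {{order^n≢0}} (begin
      Γ₁.flows tl hd Γ₁.𝟘 * Γ₁.order ^ n            ≡⟨ Γ₁.flows-count tl hd ⟩
      Γ₁.order ^ m * Γ₁.order ^ components tl hd
        ≡⟨ cong (λ q → q ^ m * q ^ components tl hd) order≡ ⟩
      Γ₂.order ^ m * Γ₂.order ^ components tl hd    ≡⟨ Γ₂.flows-count tl hd ⟨
      Γ₂.flows tl hd Γ₂.𝟘 * Γ₂.order ^ n
        ≡⟨ cong (λ q → Γ₂.flows tl hd Γ₂.𝟘 * q ^ n) order≡ ⟨
      Γ₂.flows tl hd Γ₂.𝟘 * Γ₁.order ^ n            ∎)
      where
      order^n≢0 : ℤ.NonZero (Γ₁.order ^ n)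
      order^n≢0 = ℤ.≢-nonZero λ order^n≡0 → contradiction (i^n≡0⇒i≡0 Γ₁.order n order^n≡0) λ ()

    -- Induction on the number of constrained edges, for all choices of free edges at once. By
    -- `mixedFlows-release` the count is the one with the first constrained edge freed minus the one
    -- with it deleted, and both have fewer constrained edges.
    mixedFlows-order : (tl₁ hd₁ : Fin l → Fin n) (tl₂ hd₂ : Fin m → Fin n) →
      Γ₁.mixedFlows tl₁ hd₁ tl₂ hd₂ ≡ Γ₂.mixedFlows tl₁ hd₁ tl₂ hd₂
    mixedFlows-order {m = zero}  tl₁ hd₁ tl₂ hd₂ = flows-order tl₁ hd₁
    mixedFlows-order {m = suc m} tl₁ hd₁ tl₂ hd₂ = +-cancelˡ (Γ₁.mixedFlows tl₁ hd₁ tl₂′ hd₂′) _ _ (begin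
      Γ₁.mixedFlows tl₁ hd₁ tl₂′ hd₂′ + Γ₁.mixedFlows tl₁ hd₁ tl₂ hd₂
        ≡⟨ Γ₁.mixedFlows-release tl₁ hd₁ tl₂ hd₂ ⟨
      Γ₁.mixedFlows (s Vector.∷ tl₁) (t Vector.∷ hd₁) tl₂′ hd₂′
        ≡⟨ mixedFlows-order (s Vector.∷ tl₁) (t Vector.∷ hd₁) tl₂′ hd₂′ ⟩
      Γ₂.mixedFlows (s Vector.∷ tl₁) (t Vector.∷ hd₁) tl₂′ hd₂′
        ≡⟨ Γ₂.mixedFlows-release tl₁ hd₁ tl₂ hd₂ ⟩
      Γ₂.mixedFlows tl₁ hd₁ tl₂′ hd₂′ + Γ₂.mixedFlows tl₁ hd₁ tl₂ hd₂
        ≡⟨ cong (_+ Γ₂.mixedFlows tl₁ hd₁ tl₂ hd₂) (mixedFlows-order tl₁ hd₁ tl₂′ hd₂′) ⟨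
      Γ₁.mixedFlows tl₁ hd₁ tl₂′ hd₂′ + Γ₂.mixedFlows tl₁ hd₁ tl₂ hd₂ ∎)
      where
      tl₂′ = tl₂ ∘ suc
      hd₂′ = hd₂ ∘ suc
      s = tl₂ zero
      t = hd₂ zero

    nowhereZeroFlows-order : (tl hd : Fin m → Fin n) →
                             Γ₁.nowhereZeroFlows tl hd ≡ Γ₂.nowhereZeroFlows tl hd
    nowhereZeroFlows-order = mixedFlows-order {l = 0} (λ ()) (λ ())

-- The groups ℤ₂, ℤ₂ × ℤ₂ and ℤ₄

ℤ₂ : FiniteAbelianGroup
ℤ₂ = record
  { _∙_ = _xor_
  ; ε   = false
  ; _⁻¹ = id
  ; isAbelianGroup = record
    { isGroup = record
      { isMonoid = record
        { isSemigroup = record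
          { isMagma = record { isEquivalence = isEquivalence ; ∙-cong = cong₂ _xor_ }
          ; assoc   = Bool.xor-assoc
          }
        ; identity = Bool.xor-identity
        }
      ; inverse = Bool.xor-same , Bool.xor-same
      ; ⁻¹-cong = id
      }
    ; comm = Bool.xor-comm
    }
  ; _≟_      = Bool._≟_
  ; others   = true ∷ []
  ; unique   = from-yes (unique? (false ∷ true ∷ []))
  ; complete = λ { false → here refl ; true → there (here refl) }
  }
  where open DecUnique Bool._≟_ using (unique?)

ℤ₂² : FiniteAbelianGroup
ℤ₂² = record
  { _∙_ = λ (x , y) (z , w) → x xor z , y xor w
  ; ε   = false , false
  ; _⁻¹ = id
  ; isAbelianGroup = record
    { isGroup = record
      { isMonoid = record
        { isSemigroup = record
          { isMagma = record { isEquivalence = isEquivalence ; ∙-cong = cong₂ _ }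
          ; assoc   = λ (x , y) (z , w) (u , v) →
              cong₂ _,_ (Bool.xor-assoc x z u) (Bool.xor-assoc y w v)
          }
        ; identity = (λ _ → refl) ,
                     (λ (x , y) → cong₂ _,_ (Bool.xor-identityʳ x) (Bool.xor-identityʳ y))
        }
      ; inverse = (λ (x , y) → cong₂ _,_ (Bool.xor-same x) (Bool.xor-same y)) ,
                  (λ (x , y) → cong₂ _,_ (Bool.xor-same x) (Bool.xor-same y))
      ; ⁻¹-cong = id
      }
    ; comm = λ (x , y) (z , w) → cong₂ _,_ (Bool.xor-comm x z) (Bool.xor-comm y w)
    }
  ; _≟_      = ≡-dec Bool._≟_ Bool._≟_
  ; others   = (false , true) ∷ (true , false) ∷ (true , true) ∷ []
  ; unique   = from-yes (unique?
      ((false , false) ∷ (false , true) ∷ (true , false) ∷ (true , true) ∷ []))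
  ; complete = λ
    { (false , false) → here refl
    ; (false , true)  → there (here refl)
    ; (true  , false) → there (there (here refl))
    ; (true  , true)  → there (there (there (here refl)))
    }
  }
  where open DecUnique (≡-dec Bool._≟_ Bool._≟_) using (unique?)

infixl 6 _+₄_
_+₄_ : Fin 4 → Fin 4 → Fin 4
i +₄ j = (toℕ i ℕ.+ toℕ j) mod 4

-₄_ : Fin 4 → Fin 4
-₄ i = (4 ∸ toℕ i) mod 4

ℤ₄ : FiniteAbelianGroup
ℤ₄ = record
  { _∙_ = _+₄_
  ; ε   = zero
  ; _⁻¹ = -₄_
  ; isAbelianGroup = record
    { isGroup = record
      { isMonoid = record
        { isSemigroup = record
          { isMagma = record { isEquivalence = isEquivalence ; ∙-cong = cong₂ _+₄_ }
          ; assoc   = from-yes (all? λ i → all? λ j → all? λ k → (i +₄ j +₄ k) Fin.≟ (i +₄ (j +₄ k)))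
          }
        ; identity = from-yes (all? λ i → (zero +₄ i) Fin.≟ i) ,
                     from-yes (all? λ i → (i +₄ zero) Fin.≟ i)
        }
      ; inverse = from-yes (all? λ i → ((-₄ i) +₄ i) Fin.≟ zero) ,
                  from-yes (all? λ i → (i +₄ (-₄ i)) Fin.≟ zero)
      ; ⁻¹-cong = cong -₄_
      }
    ; comm = from-yes (all? λ i → all? λ j → (i +₄ j) Fin.≟ (j +₄ i))
    }
  ; _≟_      = Fin._≟_
  ; others   = suc zero ∷ suc (suc zero) ∷ suc (suc (suc zero)) ∷ []
  -- `zero ∷ others` is definitionally `allFin 4`, the list of values used in `F G 4`.
  ; unique   = allFin⁺ 4
  ; complete = ∈-allFin
  }

-- Degrees, Kirchhoff's law and boundaries

module _ (Γ : FiniteAbelianGroup) where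
  open FiniteAbelianGroup Γ

  -- Applied to `parity` and to `_mod 4`, it carries degrees and flow sums, which are taken in ℕ,
  -- into the groups.
  sum-homo : (φ : ℕ → Carrier) → φ 0 ≡ ε → (∀ i j → φ (i ℕ.+ j) ≡ φ i ∙ φ j) →
             (x : Fin m → ℕ) → φ (ℕΣ.sum x) ≡ sum (φ ∘ x)
  sum-homo {zero}  φ φ-0 φ-+ x = φ-0
  sum-homo {suc m} φ φ-0 φ-+ x =
    trans (φ-+ (x zero) _) (cong (φ (x zero) ∙_) (sum-homo φ φ-0 φ-+ (x ∘ suc)))

parity : ℕ → Bool
parity zero    = false
parity (suc n) = not (parity n)

parity-+ : ∀ i j → parity (i ℕ.+ j) ≡ parity i xor parity j
parity-+ zero    j = refl
parity-+ (suc i) j = trans (cong not (parity-+ i j)) (Bool.not-distribˡ-xor (parity i) (parity j))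

even⇒2∣ : ∀ n → parity n ≡ false → 2 ∣ n
even⇒2∣ zero          eq = 2 ∣0
even⇒2∣ (suc (suc n)) eq =
  ∣m∣n⇒∣m+n ∣-refl (even⇒2∣ n (trans (sym (Bool.not-involutive (parity n))) eq))

2∣⇒even : ∀ {n} → 2 ∣ n → parity n ≡ false
2∣⇒even (divides q refl) = even q
  where
  even : ∀ q → parity (q ℕ.* 2) ≡ false
  even zero    = refl
  even (suc q) = trans (Bool.not-involutive (parity (q ℕ.* 2))) (even q)

mod-+ : ∀ i j → (i ℕ.+ j) mod 4 ≡ (i mod 4) +₄ (j mod 4)
mod-+ i j = toℕ-injective (begin
  toℕ ((i ℕ.+ j) mod 4)                       ≡⟨ toℕ-fromℕ< (m%n<n (i ℕ.+ j) 4) ⟩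
  (i ℕ.+ j) % 4                               ≡⟨ %-distribˡ-+ i j 4 ⟩
  ((i % 4) ℕ.+ (j % 4)) % 4
    ≡⟨ cong₂ (λ x y → (x ℕ.+ y) % 4) (toℕ-fromℕ< (m%n<n i 4)) (toℕ-fromℕ< (m%n<n j 4)) ⟨
  (toℕ (i mod 4) ℕ.+ toℕ (j mod 4)) % 4       ≡⟨ toℕ-fromℕ< (m%n<n (toℕ (i mod 4) ℕ.+ toℕ (j mod 4)) 4) ⟨
  toℕ ((i mod 4) +₄ (j mod 4))                ∎)

mod-toℕ : ∀ (i : Fin 4) → toℕ i mod 4 ≡ i
mod-toℕ = from-yes (all? λ i → (toℕ i mod 4) Fin.≟ i)

mod≡⇒%≡ : ∀ i j → i mod 4 ≡ j mod 4 → i % 4 ≡ j % 4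
mod≡⇒%≡ i j eq = trans (sym (toℕ-fromℕ< (m%n<n i 4))) (trans (cong toℕ eq) (toℕ-fromℕ< (m%n<n j 4)))

%≡⇒mod≡ : ∀ i j → i % 4 ≡ j % 4 → i mod 4 ≡ j mod 4
%≡⇒mod≡ i j eq = toℕ-injective
  (trans (toℕ-fromℕ< (m%n<n i 4)) (trans eq (sym (toℕ-fromℕ< (m%n<n j 4)))))

module ℤ₂ = Flow ℤ₂
module ℤ₂² = Flow ℤ₂²
module ℤ₄ = Flow ℤ₄

module _ (G : Graph) where
  open Graph G

  -- In `ℤ₂` inversion is the identity, so the orientation disappears from `∂`; the two ends of a
  -- loop cancel, matching its contribution 2 to the degree.
  parity-degree : ∀ A v → parity (degree G A v) ≡ ℤ₂.boundary tail head A v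
  parity-degree A v = trans (sum-homo ℤ₂ {∣E∣} parity refl parity-+ _) (ℤ₂.sum-cong-≗ lemma)
    where
    lemma : ∀ e → parity (if lookup A e then 𝟙 (tail e Fin.≟ v) ℕ.+ 𝟙 (head e Fin.≟ v) else 0) ≡
                  ℤ₂.∂ (tail e) (head e) (lookup A e) v
    lemma e with lookup A e | does (tail e Fin.≟ v) | does (head e Fin.≟ v)
    ... | true  | true  | true  = refl
    ... | true  | true  | false = refl
    ... | true  | false | true  = refl
    ... | true  | false | false = refl
    ... | false | true  | true  = refl
    ... | false | true  | false = refl
    ... | false | false | true  = refl
    ... | false | false | false = refl

  eulerian-boundary : ∀ A → does (eulerian? G A) ≡ does (ℤ₂.zero? (ℤ₂.boundary tail head A))
  eulerian-boundary A = does-⇔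
    (mk⇔ (λ eul v → trans (sym (parity-degree A v)) (2∣⇒even (eul v)))
         (λ eq v → even⇒2∣ _ (trans (parity-degree A v) (eq v))))
    (eulerian? G A) (ℤ₂.zero? _)

  boundary-pair : (tl hd : Fin m → Fin n) (Z : Vec (Bool × Bool) m) → ∀ v →
    ℤ₂².boundary tl hd Z v ≡
    (ℤ₂.boundary tl hd (Vec.map proj₁ Z) v , ℤ₂.boundary tl hd (Vec.map proj₂ Z) v)
  boundary-pair tl hd []            v = refl
  boundary-pair tl hd ((x , y) ∷ Z) v = cong₂ ℤ₂²._∙_ ∂-pair (boundary-pair (tl ∘ suc) (hd ∘ suc) Z v)
    where
    ∂-pair : ℤ₂².∂ (tl zero) (hd zero) (x , y) v ≡
             (ℤ₂.∂ (tl zero) (hd zero) x v , ℤ₂.∂ (tl zero) (hd zero) y v)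
    ∂-pair with does (tl zero Fin.≟ v) | does (hd zero Fin.≟ v)
    ... | true  | true  = refl
    ... | true  | false = refl
    ... | false | true  = refl
    ... | false | false = refl

  balanced-pair : ∀ Z → ℤ₂².balanced (ℤ₂².boundary tail head Z) ≡
    ⟦ does (eulerian? G (Vec.map proj₁ Z)) ∧ does (eulerian? G (Vec.map proj₂ Z)) ⟧
  balanced-pair Z = cong ⟦_⟧ (trans
    (does-⇔ (mk⇔
      (λ eq → (λ v → cong proj₁ (trans (sym (∂Z v)) (eq v))) ,
              (λ v → cong proj₂ (trans (sym (∂Z v)) (eq v))))
      (λ (eq₁ , eq₂) v → trans (∂Z v) (cong₂ _,_ (eq₁ v) (eq₂ v))))
      (ℤ₂².zero? (ℤ₂².boundary tail head Z))
      (ℤ₂.zero? (ℤ₂.boundary tail head (Vec.map proj₁ Z)) ×-dec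
       ℤ₂.zero? (ℤ₂.boundary tail head (Vec.map proj₂ Z))))
    (cong₂ _∧_ (sym (eulerian-boundary (Vec.map proj₁ Z))) (sym (eulerian-boundary (Vec.map proj₂ Z)))))
    where
    ∂Z = boundary-pair tail head Z

  -- Inflow is added rather than subtracted because it is a sum in ℕ; adding it cancels the inverses
  -- at the heads of the edges.
  boundary-flow : ∀ (f : Vec (Fin 4) ∣E∣) v →
    ℤ₄.boundary tail head f v +₄ (inflow G 4 f v mod 4) ≡ outflow G 4 f v mod 4
  boundary-flow f v = begin
    ℤ₄.boundary tail head f v +₄ (inflow G 4 f v mod 4)
      ≡⟨ cong (ℤ₄.boundary tail head f v +₄_) (flow-mod head) ⟩
    ℤ₄.boundary tail head f v +₄ ℤ₄.sum (λ e → (lookup f e ℤ₄.at head e) v)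
      ≡⟨ ℤ₄.sum-∙ (λ e → ℤ₄.∂ (tail e) (head e) (lookup f e) v) _ ⟨
    ℤ₄.sum (λ e → ℤ₄.∂ (tail e) (head e) (lookup f e) v +₄ (lookup f e ℤ₄.at head e) v)
      ≡⟨ ℤ₄.sum-cong-≗ (λ e → cancel ((lookup f e ℤ₄.at tail e) v) ((lookup f e ℤ₄.at head e) v)) ⟩
    ℤ₄.sum (λ e → (lookup f e ℤ₄.at tail e) v)
      ≡⟨ flow-mod tail ⟨
    outflow G 4 f v mod 4 ∎
    where
    cancel : ∀ i j → i +₄ (-₄ j) +₄ j ≡ i
    cancel = from-yes (all? λ i → all? λ j → (i +₄ (-₄ j) +₄ j) Fin.≟ i)
    flow-mod : ∀ (end : E → V) →
      (ℕΣ.sum λ e → if does (end e Fin.≟ v) then toℕ (lookup f e) else 0) mod 4 ≡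
      ℤ₄.sum (λ e → (lookup f e ℤ₄.at end e) v)
    flow-mod end = trans (sum-homo ℤ₄ {∣E∣} (_mod 4) refl mod-+ _) (ℤ₄.sum-cong-≗ lemma)
      where
      lemma : ∀ e → (if does (end e Fin.≟ v) then toℕ (lookup f e) else 0) mod 4 ≡
                    (lookup f e ℤ₄.at end e) v
      lemma e with does (end e Fin.≟ v)
      ... | true  = mod-toℕ (lookup f e)
      ... | false = refl

  F≡nowhereZeroFlows : pos (F G 4) ≡ ℤ₄.nowhereZeroFlows tail head
  F≡nowhereZeroFlows = begin
    pos (F G 4)
      ≡⟨ length-filter≡∑ (nowhereZeroFlow? G 4) (vectors (allFin 4) ∣E∣) ⟩
    (∑ (vectors (allFin 4) ∣E∣) λ f → ⟦ does (nowhereZeroFlow? G 4 f) ⟧)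
      ≡⟨ ∑-cong (vectors (allFin 4) ∣E∣) (λ f → trans
           (cong ⟦_⟧ (does-⇔ (flow⇔ f) (nowhereZeroFlow? G 4 f)
             (ℤ₄.nowhereZero? f ×-dec ℤ₄.zero? (ℤ₄.boundary tail head f))))
           (⟦∧⟧ (does (ℤ₄.nowhereZero? f)) _)) ⟩
    (∑ (vectors (allFin 4) ∣E∣) λ f →
       ⟦ does (ℤ₄.nowhereZero? f) ⟧ * ℤ₄.balanced (ℤ₄.boundary tail head f))
      ≡⟨ ℤ₄.nowhereZeroFlows≡∑ tail head ⟨
    ℤ₄.nowhereZeroFlows tail head ∎
    where
    -- By `boundary-flow`, cancelling the inflow shows that the boundary vanishes exactly when
    -- inflow and outflow agree modulo 4.
    flow⇔ = λ f → mk⇔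
      (λ (nz , bal) → (λ e fe≡0 → nz e (cong toℕ fe≡0)) ,
        λ v → ℤ₄.∙-cancelʳ (inflow G 4 f v mod 4) _ zero (trans (boundary-flow f v)
          (trans (%≡⇒mod≡ (outflow G 4 f v) (inflow G 4 f v) (sym (bal v)))
                 (sym (ℤ₄.identityˡ (inflow G 4 f v mod 4))))))
      (λ (nz , bal) → (λ e fe≡0 → nz e (toℕ-injective fe≡0)) ,
        λ v → mod≡⇒%≡ (inflow G 4 f v) (outflow G 4 f v) (trans (sym (ℤ₄.identityˡ _))
          (trans (cong (_+₄ (inflow G 4 f v mod 4)) (sym (bal v))) (boundary-flow f v))))

  F≡nowhereZeroFlows-ℤ₂² : pos (F G 4) ≡ ℤ₂².nowhereZeroFlows tail head
  F≡nowhereZeroFlows-ℤ₂² = trans F≡nowhereZeroFlows (nowhereZeroFlows-order ℤ₄ ℤ₂² refl tail head)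

-- Functions on ℕ that change sign under a shift by 3

Antiperiodic : (ℕ → ℤ) → Set
Antiperiodic c = ∀ j → c (3 ℕ.+ j) ≡ - c j

T : (ℕ → ℤ) → ℕ → ℤ
T c j = c (1 ℕ.+ j) + c (2 ℕ.+ j)

T^ : ℕ → (ℕ → ℤ) → ℕ → ℤ
T^ zero    c = c
T^ (suc m) c = T^ m (T c)

T-antiperiodic : ∀ {c} → Antiperiodic c → Antiperiodic (T c)
T-antiperiodic {c} anti j =
  trans (cong₂ _+_ (anti (1 ℕ.+ j)) (anti (2 ℕ.+ j))) (sym (neg-distrib-+ (c (1 ℕ.+ j)) _))

-- The functions annihilated by x² − x + 1, a factor of x³ + 1 = (x + 1)(x² − x + 1).
Harmonic : (ℕ → ℤ) → Set
Harmonic c = ∀ j → c (2 ℕ.+ j) ≡ c (1 ℕ.+ j) - c j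

T-harmonic : ∀ c → Harmonic c → Harmonic (T c)
T-harmonic c harm j = trans (cong₂ _+_ (harm (1 ℕ.+ j)) (harm (2 ℕ.+ j)))
  (lemma (c (1 ℕ.+ j)) (c (2 ℕ.+ j)) (c (3 ℕ.+ j)))
  where
  lemma : ∀ x y z → (y - x) + (z - y) ≡ (y + z) - (x + y)
  lemma = solve-∀

-- (x + x²)(x² - x + 1) = x(x³ + 1), which annihilates antiperiodic functions.
antiperiodic⇒T-harmonic : ∀ {c} → Antiperiodic c → Harmonic (T c)
antiperiodic⇒T-harmonic {c} anti j = trans (cong₂ _+_ (anti j) (anti (1 ℕ.+ j)))
  (trans (lemma (c j) (c (1 ℕ.+ j)) (c (2 ℕ.+ j)))
    (cong (λ i → c (2 ℕ.+ j) + i - (c (1 ℕ.+ j) + c (2 ℕ.+ j))) (sym (anti j))))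
  where
  lemma : ∀ x y z → - x + - y ≡ z + - x - (y + z)
  lemma = solve-∀

-- (x + x²)² = −3 modulo x² − x + 1.
T²-harmonic : ∀ c → Harmonic c → ∀ j → T (T c) j ≡ - pos 3 * c j
T²-harmonic c harm j = trans
  (cong (λ i → (c (2 ℕ.+ j) + c (3 ℕ.+ j)) + (c (3 ℕ.+ j) + i)) (harm (2 ℕ.+ j)))
  (trans (cong (λ i → (c (2 ℕ.+ j) + i) + (i + (i - c (2 ℕ.+ j)))) (harm (1 ℕ.+ j)))
  (trans (cong (λ i → (i + (i - c (1 ℕ.+ j))) + ((i - c (1 ℕ.+ j)) + ((i - c (1 ℕ.+ j)) - i))) (harm j))
    (lemma (c j) (c (1 ℕ.+ j)))))
  where
  lemma : ∀ x y → ((y - x) + ((y - x) - y)) + (((y - x) - y) + (((y - x) - y) - (y - x))) ≡ - pos 3 * x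
  lemma = solve-∀

-- Since T² = -3 relates every second iterate, two nonzero starting values are carried along: the
-- pair for `c` and `T c` becomes the pair for `T c` and `T (T c)`.
T^-nonzero : ∀ m {c} → Harmonic c → c 0 ≢ 0ℤ → T c 0 ≢ 0ℤ → T^ m c 0 ≢ 0ℤ
T^-nonzero zero    harm c≢0 Tc≢0 = c≢0
T^-nonzero (suc m) {c} harm c≢0 Tc≢0 = T^-nonzero m (T-harmonic c harm) Tc≢0
  λ T²c≡0 → [ (λ ()) , c≢0 ]
    (i*j≡0⇒i≡0∨j≡0 (- pos 3) (trans (sym (T²-harmonic c harm 0)) T²c≡0))

± : Bool → ℤ
± b = if b then 1ℤ else -1ℤ

low? : ∀ j → Dec (j % 6 ≡ 0 ⊎ j % 6 ≡ 1 ⊎ j % 6 ≡ 2)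
low? j = (j % 6 ℕ.≟ 0) ⊎-dec (j % 6 ℕ.≟ 1) ⊎-dec (j % 6 ℕ.≟ 2)

sign : ℕ → ℤ
sign j = ± (does (low? j))

sign-periodic : ∀ j → sign (6 ℕ.+ j) ≡ sign j
sign-periodic j = cong (λ r → ± (does ((r ℕ.≟ 0) ⊎-dec (r ℕ.≟ 1) ⊎-dec (r ℕ.≟ 2))))
  (trans (cong (_% 6) (ℕ.+-comm 6 j)) ([m+n]%n≡m%n j 6))

sign-antiperiodic : Antiperiodic sign
sign-antiperiodic 0 = refl
sign-antiperiodic 1 = refl
sign-antiperiodic 2 = refl
sign-antiperiodic (suc (suc (suc j))) = begin
  sign (6 ℕ.+ j)     ≡⟨ sign-periodic j ⟩
  sign j             ≡⟨ neg-involutive (sign j) ⟨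
  - - sign j         ≡⟨ cong -_ (sign-antiperiodic j) ⟨
  - sign (3 ℕ.+ j)   ∎

T^-sign-nonzero : ∀ m → T^ m sign 0 ≢ 0ℤ
T^-sign-nonzero zero    = λ ()
T^-sign-nonzero (suc m) =
  -- `sign` is not harmonic, so the induction starts from `T sign`; the starting values at 0 are
  -- `T sign 0` = 2 and `T (T sign) 0` = -2.
  T^-nonzero m (antiperiodic⇒T-harmonic sign-antiperiodic) (λ ()) (λ ())

-- Sums over subsets

∑-subsets-suc : ∀ m (c : Subset (suc m) → ℤ) →
  ∑ (subsets (suc m)) c ≡ ∑ (subsets m) (c ∘ (false ∷_)) + ∑ (subsets m) (c ∘ (true ∷_))
∑-subsets-suc m c = trans (∑-cartesianProductWith _∷_ (false ∷ true ∷ []) (subsets m) c)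
  (cong (∑ (subsets m) (c ∘ (false ∷_)) +_) (+-identityʳ _))

-- The operator (1 + x)^m, with x the shift; three nested copies sum over triples of subsets.
W : ℕ → (ℕ → ℤ) → ℕ → ℤ
W m c j = ∑ (subsets m) λ A → c (∣ A ∣ ℕ.+ j)

W-cong : ∀ m {c d} → c ≗ d → W m c ≗ W m d
W-cong m c≗d j = ∑-cong (subsets m) λ A → c≗d (∣ A ∣ ℕ.+ j)

-- The operator 1 + x: an edge is either left out of a set or put into it.
D : (ℕ → ℤ) → ℕ → ℤ
D c j = c j + c (1 ℕ.+ j)

W-suc : ∀ m c → W (suc m) c ≗ W m (D c)
W-suc m c j = trans (∑-subsets-suc m _) (sym (∑-distrib-+ (subsets m) _ _))

D-W : ∀ m c → D (W m c) ≗ W m (D c)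
D-W m c j = trans
  (cong (W m c j +_) (∑-cong (subsets m) λ A → cong c (ℕ.+-suc ∣ A ∣ j)))
  (sym (∑-distrib-+ (subsets m) _ _))

D-cong : ∀ {c d} → c ≗ d → D c ≗ D d
D-cong c≗d j = cong₂ _+_ (c≗d j) (c≗d (1 ℕ.+ j))

W³ : ℕ → (ℕ → ℤ) → ℕ → ℤ
W³ m c = W m (W m (W m c))

W³-cong : ∀ m {c d} → c ≗ d → W³ m c ≗ W³ m d
W³-cong m c≗d = W-cong m (W-cong m (W-cong m c≗d))

-- One edge is split off each of the three sums, and the resulting factors 1 + x commute past `W`.
W³-suc : ∀ m c → W³ (suc m) c ≗ W³ m (D (D (D c)))
W³-suc m c j = begin
  W (suc m) (W (suc m) (W (suc m) c)) j ≡⟨ W-suc m (W (suc m) (W (suc m) c)) j ⟩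
  W m (D (W (suc m) (W (suc m) c))) j   ≡⟨ W-cong m (D-cong (W-suc m (W (suc m) c))) j ⟩
  W m (D (W m (D (W (suc m) c)))) j     ≡⟨ W-cong m (D-cong (W-cong m (D-cong (W-suc m c)))) j ⟩
  W m (D (W m (D (W m (D c))))) j       ≡⟨ W-cong m (D-cong (W-cong m (D-W m (D c)))) j ⟩
  W m (D (W m (W m (D (D c))))) j       ≡⟨ W-cong m (D-W m (W m (D (D c)))) j ⟩
  W m (W m (D (W m (D (D c))))) j       ≡⟨ W-cong m (W-cong m (D-W m (D (D c)))) j ⟩
  W³ m (D (D (D c))) j                  ∎

W-* : ∀ m i c → W m (λ j → i * c j) ≗ (λ j → i * W m c j)
W-* m i c j = ∑-distribˡ-* (subsets m) i _

W³-* : ∀ m i c → W³ m (λ j → i * c j) ≗ (λ j → i * W³ m c j)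
W³-* m i c j = begin
  W m (W m (W m (λ j → i * c j))) j  ≡⟨ W-cong m (W-cong m (W-* m i c)) j ⟩
  W m (W m (λ j → i * W m c j)) j    ≡⟨ W-cong m (W-* m i (W m c)) j ⟩
  W m (λ j → i * W m (W m c) j) j    ≡⟨ W-* m i (W m (W m c)) j ⟩
  i * W³ m c j                       ∎

-- (1 + x)³ = 3(x + x²) modulo x³ + 1.
D³-antiperiodic : ∀ {c} → Antiperiodic c → D (D (D c)) ≗ (λ j → pos 3 * T c j)
D³-antiperiodic {c} anti j = trans
  (cong (λ i → ((x + y) + (y + z)) + ((y + z) + (z + i))) (anti j)) (lemma x y z)
  where
  x = c j
  y = c (1 ℕ.+ j)
  z = c (2 ℕ.+ j)
  lemma : ∀ x y z → ((x + y) + (y + z)) + ((y + z) + (z + - x)) ≡ pos 3 * (y + z)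
  lemma = solve-∀

W³-antiperiodic : ∀ m {c} → Antiperiodic c → ∀ j → W³ m c j ≡ pos 3 ^ m * T^ m c j
W³-antiperiodic zero {c} anti j =
  trans (+-identityʳ _) (trans (+-identityʳ _) (trans (+-identityʳ _) (sym (*-identityˡ (c j)))))
W³-antiperiodic (suc m) {c} anti j = begin
  W³ (suc m) c j                      ≡⟨ W³-suc m c j ⟩
  W³ m (D (D (D c))) j                ≡⟨ W³-cong m (D³-antiperiodic anti) j ⟩
  W³ m (λ j → pos 3 * T c j) j        ≡⟨ W³-* m (pos 3) (T c) j ⟩
  pos 3 * W³ m (T c) j                ≡⟨ cong (pos 3 *_) (W³-antiperiodic m (T-antiperiodic anti) j) ⟩
  pos 3 * (pos 3 ^ m * T^ m (T c) j)  ≡⟨ *-assoc (pos 3) (pos 3 ^ m) (T^ m (T c) j) ⟨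
  pos 3 ^ suc m * T^ m (T c) j        ∎

-- Symmetric differences

△≡xor : ∀ (A B : Subset m) → A △ B ≡ zipWith _xor_ A B
△≡xor []          []          = refl
△≡xor (true ∷ A)  (true ∷ B)  = cong (false ∷_) (△≡xor A B)
△≡xor (true ∷ A)  (false ∷ B) = cong (true ∷_) (△≡xor A B)
△≡xor (false ∷ A) (true ∷ B)  = cong (true ∷_) (△≡xor A B)
△≡xor (false ∷ A) (false ∷ B) = cong (false ∷_) (△≡xor A B)

△-comm : ∀ (A B : Subset m) → A △ B ≡ B △ A
△-comm A B = begin
  A △ B             ≡⟨ △≡xor A B ⟩
  zipWith _xor_ A B ≡⟨ zipWith-comm Bool.xor-comm A B ⟩
  zipWith _xor_ B A ≡⟨ △≡xor B A ⟨
  B △ A             ∎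

△-assoc : ∀ (A B C : Subset m) → (A △ B) △ C ≡ A △ (B △ C)
△-assoc A B C = begin
  (A △ B) △ C                           ≡⟨ △≡xor (A △ B) C ⟩
  zipWith _xor_ (A △ B) C               ≡⟨ cong (λ X → zipWith _xor_ X C) (△≡xor A B) ⟩
  zipWith _xor_ (zipWith _xor_ A B) C   ≡⟨ zipWith-assoc Bool.xor-assoc A B C ⟩
  zipWith _xor_ A (zipWith _xor_ B C)   ≡⟨ cong (zipWith _xor_ A) (△≡xor B C) ⟨
  zipWith _xor_ A (B △ C)               ≡⟨ △≡xor A (B △ C) ⟨
  A △ (B △ C)                           ∎

△-cancelˡ : ∀ (A X : Subset m) → A △ (A △ X) ≡ X
△-cancelˡ []          []          = refl
△-cancelˡ (true ∷ A)  (true ∷ X)  = cong (true ∷_) (△-cancelˡ A X)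
△-cancelˡ (true ∷ A)  (false ∷ X) = cong (false ∷_) (△-cancelˡ A X)
△-cancelˡ (false ∷ A) (true ∷ X)  = cong (true ∷_) (△-cancelˡ A X)
△-cancelˡ (false ∷ A) (false ∷ X) = cong (false ∷_) (△-cancelˡ A X)

△-triangle : ∀ (A X Y : Subset m) → (A △ X) △ (A △ Y) ≡ X △ Y
△-triangle A X Y = begin
  (A △ X) △ (A △ Y) ≡⟨ cong (_△ (A △ Y)) (△-comm A X) ⟩
  (X △ A) △ (A △ Y) ≡⟨ △-assoc X A (A △ Y) ⟩
  X △ (A △ (A △ Y)) ≡⟨ cong (X △_) (△-cancelˡ A Y) ⟩
  X △ Y             ∎

lookup-△ : ∀ (A B : Subset m) e → lookup (A △ B) e ≡ lookup A e xor lookup B e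
lookup-△ A B e = trans (cong (λ C → lookup C e) (△≡xor A B)) (lookup-zipWith _xor_ e A B)

∑-△ : ∀ (A : Subset m) c → ∑ (subsets m) (λ B → c (A △ B)) ≡ ∑ (subsets m) c
∑-△ []          c = refl
∑-△ {suc m} (false ∷ A) c = begin
  ∑ (subsets (suc m)) (λ B → c ((false ∷ A) △ B)) ≡⟨ ∑-subsets-suc m _ ⟩
  ∑ (subsets m) (λ B → c (false ∷ (A △ B))) + ∑ (subsets m) (λ B → c (true ∷ (A △ B)))
    ≡⟨ cong₂ _+_ (∑-△ A (c ∘ (false ∷_))) (∑-△ A (c ∘ (true ∷_))) ⟩
  ∑ (subsets m) (c ∘ (false ∷_)) + ∑ (subsets m) (c ∘ (true ∷_)) ≡⟨ ∑-subsets-suc m c ⟨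
  ∑ (subsets (suc m)) c ∎
∑-△ {suc m} (true ∷ A) c = begin
  ∑ (subsets (suc m)) (λ B → c ((true ∷ A) △ B)) ≡⟨ ∑-subsets-suc m _ ⟩
  ∑ (subsets m) (λ B → c (true ∷ (A △ B))) + ∑ (subsets m) (λ B → c (false ∷ (A △ B)))
    ≡⟨ cong₂ _+_ (∑-△ A (c ∘ (true ∷_))) (∑-△ A (c ∘ (false ∷_))) ⟩
  ∑ (subsets m) (c ∘ (true ∷_)) + ∑ (subsets m) (c ∘ (false ∷_)) ≡⟨ +-comm (∑ (subsets m) _) _ ⟩
  ∑ (subsets m) (c ∘ (false ∷_)) + ∑ (subsets m) (c ∘ (true ∷_)) ≡⟨ ∑-subsets-suc m c ⟨
  ∑ (subsets (suc m)) c ∎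

-- Pairs of edge sets as vectors over ℤ₂ × ℤ₂

pairs : ∀ m → List (Vec (Bool × Bool) m)
pairs = vectors (ℤ₂².elements)

∑-pairs : ∀ m (c : Subset m → Subset m → ℤ) →
  (∑ (subsets m) λ X → ∑ (subsets m) λ Y → c X Y) ≡
  ∑ (pairs m) λ Z → c (Vec.map proj₁ Z) (Vec.map proj₂ Z)
∑-pairs zero    c = cong (_+ 0ℤ) (+-identityʳ (c [] []))
∑-pairs (suc m) c = begin
  (∑ (subsets (suc m)) λ X → ∑ (subsets (suc m)) λ Y → c X Y)
    ≡⟨ ∑-subsets-suc m _ ⟩
  S-split false + S-split true
    ≡⟨ cong₂ _+_ (split false) (split true) ⟩
  (S false false + S false true) + (S true false + S true true)
    ≡⟨ lemma (S false false) (S false true) (S true false) (S true true) ⟩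
  S false false + (S false true + (S true false + (S true true + 0ℤ)))
    ≡⟨ ∑-cartesianProductWith _∷_ (ℤ₂².elements) (pairs m) _ ⟨
  (∑ (pairs (suc m)) λ Z → c (Vec.map proj₁ Z) (Vec.map proj₂ Z)) ∎
  where
  S : Bool → Bool → ℤ
  S x y = ∑ (pairs m) λ Z → c (x ∷ Vec.map proj₁ Z) (y ∷ Vec.map proj₂ Z)
  S-split : Bool → ℤ
  S-split x = ∑ (subsets m) λ X → ∑ (subsets (suc m)) λ Y → c (x ∷ X) Y
  split : ∀ x → S-split x ≡ S x false + S x true
  split x = begin
    S-split x
      ≡⟨ ∑-cong (subsets m) (λ X → ∑-subsets-suc m (c (x ∷ X))) ⟩
    (∑ (subsets m) λ X →
      (∑ (subsets m) λ Y → c (x ∷ X) (false ∷ Y)) + (∑ (subsets m) λ Y → c (x ∷ X) (true ∷ Y)))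
      ≡⟨ ∑-distrib-+ (subsets m) _ _ ⟩
    (∑ (subsets m) λ X → ∑ (subsets m) λ Y → c (x ∷ X) (false ∷ Y)) +
    (∑ (subsets m) λ X → ∑ (subsets m) λ Y → c (x ∷ X) (true ∷ Y))
      ≡⟨ cong₂ _+_ (∑-pairs m (λ X Y → c (x ∷ X) (false ∷ Y)))
                  (∑-pairs m (λ X Y → c (x ∷ X) (true ∷ Y))) ⟩
    S x false + S x true ∎
  lemma : ∀ i j k l → (i + j) + (k + l) ≡ i + (j + (k + (l + 0ℤ)))
  lemma = solve-∀

-- This is ∣A∣ + ∣B∣ + ∣C∣ in the coordinates A, X = A △ B, Y = A △ C, where `Z` encodes X and Y.
size : Subset m → Vec (Bool × Bool) m → ℕ
size A Z = ∣ A ∣ ℕ.+ ∣ A △ Vec.map proj₁ Z ∣ ℕ.+ ∣ A △ Vec.map proj₂ Z ∣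

bit : Bool → ℕ
bit b = if b then 1 else 0

∣∷∣ : ∀ b (B : Subset m) → ∣ b ∷ B ∣ ≡ bit b ℕ.+ ∣ B ∣
∣∷∣ true  B = refl
∣∷∣ false B = refl

∣∷△∷∣ : ∀ a b (A B : Subset m) → ∣ (a ∷ A) △ (b ∷ B) ∣ ≡ bit (a xor b) ℕ.+ ∣ A △ B ∣
∣∷△∷∣ true  true  A B = refl
∣∷△∷∣ true  false A B = refl
∣∷△∷∣ false true  A B = refl
∣∷△∷∣ false false A B = refl

size-∷ : ∀ a x y (A : Subset m) Z →
  size (a ∷ A) ((x , y) ∷ Z) ≡ bit a ℕ.+ bit (a xor x) ℕ.+ bit (a xor y) ℕ.+ size A Z
size-∷ a x y A Z = trans
  (cong₂ ℕ._+_ (cong₂ ℕ._+_ (∣∷∣ a A) (∣∷△∷∣ a x A (Vec.map proj₁ Z))) (∣∷△∷∣ a y A (Vec.map proj₂ Z)))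
  (lemma (bit a) (bit (a xor x)) (bit (a xor y))
    (∣ A ∣) (∣ A △ Vec.map proj₁ Z ∣) (∣ A △ Vec.map proj₂ Z ∣))
  where
  lemma : ∀ i j k α β γ → (i ℕ.+ α) ℕ.+ (j ℕ.+ β) ℕ.+ (k ℕ.+ γ) ≡ i ℕ.+ j ℕ.+ k ℕ.+ (α ℕ.+ β ℕ.+ γ)
  lemma = ℕSolver.solve-∀

-- If the first edge is not in A, it lies in A △ X or A △ Y exactly as it lies in X or Y; if it is
-- in A, it counts once for A and memberships in the other two are complemented.
∑-size-∷ : ∀ (c : ℕ → ℤ) x y (Z : Vec (Bool × Bool) m) →
  ∑ (subsets (suc m)) (λ A → c (size A ((x , y) ∷ Z))) ≡
  ∑ (subsets m) (λ A → c (bit x ℕ.+ bit y ℕ.+ size A Z) +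
                       c (1 ℕ.+ bit (not x) ℕ.+ bit (not y) ℕ.+ size A Z))
∑-size-∷ {m} c x y Z = begin
  ∑ (subsets (suc m)) (λ A → c (size A ((x , y) ∷ Z)))
    ≡⟨ ∑-subsets-suc m _ ⟩
  ∑ (subsets m) (λ A → c (size (false ∷ A) ((x , y) ∷ Z))) +
  ∑ (subsets m) (λ A → c (size (true ∷ A) ((x , y) ∷ Z)))
    ≡⟨ ∑-distrib-+ (subsets m) _ _ ⟨
  ∑ (subsets m) (λ A → c (size (false ∷ A) ((x , y) ∷ Z)) + c (size (true ∷ A) ((x , y) ∷ Z)))
    ≡⟨ ∑-cong (subsets m) (λ A → cong₂ (λ i j → c i + c j)
         (size-∷ false x y A Z) (size-∷ true x y A Z)) ⟩
  ∑ (subsets m) (λ A → c (bit x ℕ.+ bit y ℕ.+ size A Z) +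
                       c (1 ℕ.+ bit (not x) ℕ.+ bit (not y) ℕ.+ size A Z)) ∎

-- An edge outside X ∪ Y lies in all of A, A △ X, A △ Y or in none of them, and
-- the two contributions cancel; every other edge lies in one or two of the three.
∑-size : ∀ {c} → Antiperiodic c → ∀ (Z : Vec (Bool × Bool) m) →
  ∑ (subsets m) (λ A → c (size A Z)) ≡ ⟦ does (ℤ₂².nowhereZero? Z) ⟧ * T^ m c 0
∑-size {c = c} anti [] = trans (+-identityʳ (c 0)) (sym (*-identityˡ (c 0)))
∑-size {suc m} {c} anti ((false , false) ∷ Z) = begin
  ∑ (subsets (suc m)) (λ A → c (size A ((false , false) ∷ Z)))
    ≡⟨ ∑-size-∷ c false false Z ⟩
  ∑ (subsets m) (λ A → c (size A Z) + c (3 ℕ.+ size A Z))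
    ≡⟨ ∑-cong (subsets m) (λ A →
         trans (cong (c (size A Z) +_) (anti (size A Z))) (+-inverseʳ (c (size A Z)))) ⟩
  ∑ (subsets m) (λ A → 0ℤ)
    ≡⟨ ∑-zero (subsets m) ⟩
  0ℤ
    ≡⟨ cong (λ b → ⟦ b ⟧ * T^ (suc m) c 0) (ℤ₂².nowhereZero?-∷ (false , false) Z) ⟨
  ⟦ does (ℤ₂².nowhereZero? ((false , false) ∷ Z)) ⟧ * T^ (suc m) c 0 ∎
∑-size {suc m} {c} anti ((false , true) ∷ Z) =
  trans (∑-size-∷ c false true Z) (trans (∑-size (T-antiperiodic anti) Z)
    (sym (cong (λ b → ⟦ b ⟧ * T^ (suc m) c 0) (ℤ₂².nowhereZero?-∷ (false , true) Z))))
∑-size {suc m} {c} anti ((true , false) ∷ Z) =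
  trans (∑-size-∷ c true false Z) (trans (∑-size (T-antiperiodic anti) Z)
    (sym (cong (λ b → ⟦ b ⟧ * T^ (suc m) c 0) (ℤ₂².nowhereZero?-∷ (true , false) Z))))
∑-size {suc m} {c} anti ((true , true) ∷ Z) =
  trans (∑-size-∷ c true true Z)
    -- An edge of both X and Y lies in two of the sets when it is outside A and in one otherwise,
    -- the reverse of the order of summands in `T`.
    (trans (∑-cong (subsets m) λ A → +-comm (c (2 ℕ.+ size A Z)) _)
      (trans (∑-size (T-antiperiodic anti) Z)
        (sym (cong (λ b → ⟦ b ⟧ * T^ (suc m) c 0) (ℤ₂².nowhereZero?-∷ (true , true) Z)))))

-- Quotients of integers

/-toℚᵘ : ∀ i n .{{_ : ℕ.NonZero n}} → toℚᵘ (i / n) ℚᵘ.≃ i ℚᵘ./ n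
/-toℚᵘ i (suc n) = ℚ.toℚᵘ-fromℚᵘ (mkℚᵘ i n)

/-≢0 : ∀ {i} n .{{_ : ℕ.NonZero n}} → i ≢ 0ℤ → i / n ≢ 0ℚ
/-≢0 {i} n@(suc _) i≢0 i/n≡0 with *≡* eq ← ℚᵘ.≃-trans (ℚᵘ.≃-sym (/-toℚᵘ i n)) (ℚ.toℚᵘ-cong i/n≡0) =
  i≢0 (trans (sym (*-identityʳ i)) eq)

/-distrib-- : ∀ i j n .{{_ : ℕ.NonZero n}} → i / n ℚ.- j / n ≡ (i - j) / n
/-distrib-- i j n@(suc _) = ℚ.toℚᵘ-injective (begin′
  toℚᵘ (i / n ℚ.- j / n)               ≈⟨ ℚ.toℚᵘ-homo-+ (i / n) (ℚ.- (j / n)) ⟩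
  toℚᵘ (i / n) ℚᵘ.+ toℚᵘ (ℚ.- (j / n)) 
    ≈⟨ ℚᵘ.+-cong (/-toℚᵘ i n) (ℚᵘ.≃-trans (ℚ.toℚᵘ-homo‿- (j / n)) (ℚᵘ.-‿cong (/-toℚᵘ j n))) ⟩
  i ℚᵘ./ n ℚᵘ.- j ℚᵘ./ n               ≈⟨ *≡* (lemma i j (pos n)) ⟩
  (i - j) ℚᵘ./ n                       ≈⟨ /-toℚᵘ (i - j) n ⟨
  toℚᵘ ((i - j) / n)                   ∎′)
  where
  open import Relation.Binary.Reasoning.Setoid ℚᵘ.≃-setoid renaming (begin_ to begin′_; _∎ to _∎′)
  lemma : ∀ i j n → (i * n + - j * n) * n ≡ (i - j) * (n * n)
  lemma = solve-∀

/-* : ∀ i j m n .{{_ : ℕ.NonZero m}} .{{_ : ℕ.NonZero n}} .{{_ : ℕ.NonZero (m ℕ.* n)}} →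
      i / m ℚ.* (j / n) ≡ (i * j) / (m ℕ.* n)
/-* i j m@(suc _) n@(suc _) = ℚ.toℚᵘ-injective (begin′
  toℚᵘ (i / m ℚ.* (j / n))        ≈⟨ ℚ.toℚᵘ-homo-* (i / m) (j / n) ⟩
  toℚᵘ (i / m) ℚᵘ.* toℚᵘ (j / n)  ≈⟨ ℚᵘ.*-cong (/-toℚᵘ i m) (/-toℚᵘ j n) ⟩
  (i * j) ℚᵘ./ (m ℕ.* n)          ≈⟨ /-toℚᵘ (i * j) (m ℕ.* n) ⟨
  toℚᵘ ((i * j) / (m ℕ.* n))      ∎′)
  where
  open import Relation.Binary.Reasoning.Setoid ℚᵘ.≃-setoid renaming (begin_ to begin′_; _∎ to _∎′)

/-≡ : ∀ i j m n .{{_ : ℕ.NonZero m}} .{{_ : ℕ.NonZero n}} → i * pos n ≡ j * pos m → i / m ≡ j / n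
/-≡ i j m@(suc _) n@(suc _) eq = ℚ.toℚᵘ-injective
  (ℚᵘ.≃-trans (/-toℚᵘ i m) (ℚᵘ.≃-trans (*≡* eq) (ℚᵘ.≃-sym (/-toℚᵘ j n))))

*-÷-cancel : ∀ x y .{{_ : ℚ.NonZero y}} → (x ℚ.* y) ÷ y ≡ x
*-÷-cancel x y = begin
  x ℚ.* y ℚ.* (ℚ.1/ y)   ≡⟨ ℚ.*-assoc x y (ℚ.1/ y) ⟩
  x ℚ.* (y ℚ.* (ℚ.1/ y)) ≡⟨ cong (x ℚ.*_) (ℚ.*-inverseʳ y) ⟩
  x ℚ.* 1ℚ               ≡⟨ ℚ.*-identityʳ x ⟩
  x                      ∎

÷-distrib-- : ∀ x y z .{{_ : ℚ.NonZero z}} → x ÷ z ℚ.- y ÷ z ≡ (x ℚ.- y) ÷ z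
÷-distrib-- x y z = begin
  x ÷ z ℚ.- y ÷ z                          ≡⟨ cong (x ÷ z ℚ.+_) (ℚ.neg-distribˡ-* y (ℚ.1/ z)) ⟩
  x ℚ.* (ℚ.1/ z) ℚ.+ (ℚ.- y) ℚ.* (ℚ.1/ z)  ≡⟨ ℚ.*-distribʳ-+ (ℚ.1/ z) x (ℚ.- y) ⟨
  (x ℚ.- y) ÷ z                            ∎

-- Here `c` and `w` are the sizes of Δ and Ω, `a` and `b` count the event and its complement within
-- Δ, `p` and `p′` within Ω; `t` is the factor common to both biases. The numerator is written as
-- `Q * β * C`, so that the two divisions cancel in turn.
bias-quotient : ∀ a b c p p′ w e f g t .{{_ : ℕ.NonZero w}} .{{_ : ℕ.NonZero e}} →
  pos a - pos b ≡ pos f * t → pos p - pos p′ ≡ pos e * t → pos c * pos g ≡ pos w →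
  .{{_ : ℚ.NonZero (pos c / w)}} .{{_ : ℚ.NonZero (pos p / w ℚ.- pos p′ / w)}} →
  ((pos a / w) ÷ (pos c / w) ℚ.- (pos b / w) ÷ (pos c / w)) ÷ (pos p / w ℚ.- pos p′ / w) ≡
  pos (g ℕ.* f) / e
bias-quotient a b c p p′ w@(suc _) e@(suc _) f g t a-b p-p′ cg≡w = begin
  ((pos a / w) ÷ C ℚ.- (pos b / w) ÷ C) ÷ β ≡⟨ cong (_÷ β) (÷-distrib-- (pos a / w) (pos b / w) C) ⟩
  ((pos a / w ℚ.- pos b / w) ÷ C) ÷ β       ≡⟨ cong (λ x → (x ÷ C) ÷ β) numerator ⟩
  ((Q ℚ.* β ℚ.* C) ÷ C) ÷ β                 ≡⟨ cong (_÷ β) (*-÷-cancel (Q ℚ.* β) C) ⟩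
  (Q ℚ.* β) ÷ β                             ≡⟨ *-÷-cancel Q β ⟩
  Q                                         ∎
  where
  C = pos c / w
  β = pos p / w ℚ.- pos p′ / w
  Q = pos (g ℕ.* f) / e

  cross : (pos a - pos b) * pos (e ℕ.* w ℕ.* w) ≡ pos (g ℕ.* f) * (pos p - pos p′) * pos c * pos w
  cross = begin
    (pos a - pos b) * pos (e ℕ.* w ℕ.* w)
      ≡⟨ cong₂ _*_ a-b (trans (pos-* (e ℕ.* w) w) (cong (_* pos w) (pos-* e w))) ⟩
    pos f * t * (pos e * pos w * pos w)
      ≡⟨ cong (λ i → pos f * t * (pos e * i * pos w)) cg≡w ⟨
    pos f * t * (pos e * (pos c * pos g) * pos w)
      ≡⟨ lemma (pos f) t (pos e) (pos c) (pos g) (pos w) ⟩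
    pos g * pos f * (pos e * t) * pos c * pos w
      ≡⟨ cong₂ (λ i j → i * j * pos c * pos w) (pos-* g f) p-p′ ⟨
    pos (g ℕ.* f) * (pos p - pos p′) * pos c * pos w ∎
    where
    lemma : ∀ f t e c g w → f * t * (e * (c * g) * w) ≡ g * f * (e * t) * c * w
    lemma = solve-∀

  numerator : pos a / w ℚ.- pos b / w ≡ Q ℚ.* β ℚ.* C
  numerator = begin
    pos a / w ℚ.- pos b / w   ≡⟨ /-distrib-- (pos a) (pos b) w ⟩
    (pos a - pos b) / w
      ≡⟨ /-≡ (pos a - pos b) (pos (g ℕ.* f) * (pos p - pos p′) * pos c) w (e ℕ.* w ℕ.* w) cross ⟩
    (pos (g ℕ.* f) * (pos p - pos p′) * pos c) / (e ℕ.* w ℕ.* w)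
      ≡⟨ /-* (pos (g ℕ.* f) * (pos p - pos p′)) (pos c) (e ℕ.* w) w ⟨
    (pos (g ℕ.* f) * (pos p - pos p′)) / (e ℕ.* w) ℚ.* C
      ≡⟨ cong (ℚ._* C) (/-* (pos (g ℕ.* f)) (pos p - pos p′) e w) ⟨
    Q ℚ.* ((pos p - pos p′) / w) ℚ.* C
      ≡⟨ cong (λ y → Q ℚ.* y ℚ.* C) (/-distrib-- (pos p) (pos p′) w) ⟨
    Q ℚ.* β ℚ.* C             ∎

-- Signed counts

module _ {Σ : Pred X ℓ} (Σ? : Decidable Σ) (xs : List X) where

  signed-count : pos (length (filter Σ? xs)) - pos (length (filter (∁? Σ?) xs)) ≡
                 ∑ xs (λ x → ± (does (Σ? x)))
  signed-count = begin
    pos (length (filter Σ? xs)) - pos (length (filter (∁? Σ?) xs))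
      ≡⟨ cong₂ _-_ (length-filter≡∑ Σ? xs) (length-filter≡∑ (∁? Σ?) xs) ⟩
    ∑ xs (λ x → ⟦ does (Σ? x) ⟧) - ∑ xs (λ x → ⟦ not (does (Σ? x)) ⟧)
      ≡⟨ ∑-distrib-- xs _ _ ⟨
    ∑ xs (λ x → ⟦ does (Σ? x) ⟧ - ⟦ not (does (Σ? x)) ⟧)
      ≡⟨ ∑-cong xs (λ x → lemma (does (Σ? x))) ⟩
    ∑ xs (λ x → ± (does (Σ? x))) ∎
    where
    lemma : ∀ p → ⟦ p ⟧ - ⟦ not p ⟧ ≡ ± p
    lemma true  = refl
    lemma false = refl

  signed-count-∩ : {Δ : Pred X ℓ′} (Δ? : Decidable Δ) →
    pos (length (filter (Σ? ∩? Δ?) xs)) - pos (length (filter (∁? Σ? ∩? Δ?) xs)) ≡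
    ∑ xs (λ x → ⟦ does (Δ? x) ⟧ * ± (does (Σ? x)))
  signed-count-∩ Δ? = begin
    pos (length (filter (Σ? ∩? Δ?) xs)) - pos (length (filter (∁? Σ? ∩? Δ?) xs))
      ≡⟨ cong₂ _-_ (length-filter≡∑ (Σ? ∩? Δ?) xs) (length-filter≡∑ (∁? Σ? ∩? Δ?) xs) ⟩
    ∑ xs (λ x → ⟦ does (Σ? x) ∧ does (Δ? x) ⟧) - ∑ xs (λ x → ⟦ not (does (Σ? x)) ∧ does (Δ? x) ⟧)
      ≡⟨ ∑-distrib-- xs _ _ ⟨
    ∑ xs (λ x → ⟦ does (Σ? x) ∧ does (Δ? x) ⟧ - ⟦ not (does (Σ? x)) ∧ does (Δ? x) ⟧)
      ≡⟨ ∑-cong xs (λ x → lemma (does (Σ? x)) (does (Δ? x))) ⟩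
    ∑ xs (λ x → ⟦ does (Δ? x) ⟧ * ± (does (Σ? x))) ∎
    where
    lemma : ∀ p q → ⟦ p ∧ q ⟧ - ⟦ not p ∧ q ⟧ ≡ ⟦ q ⟧ * ± p
    lemma true  true  = refl
    lemma true  false = refl
    lemma false true  = refl
    lemma false false = refl

pos-^ : ∀ i n → pos (i ℕ.^ n) ≡ pos i ^ n
pos-^ i zero    = refl
pos-^ i (suc n) = trans (pos-* i (i ℕ.^ n)) (cong (pos i *_) (pos-^ i n))

4^≡2^² : ∀ n → pos 4 ^ n ≡ pos 2 ^ n * pos 2 ^ n
4^≡2^² zero    = refl
4^≡2^² (suc n) = trans (cong (pos 4 *_) (4^≡2^² n)) (lemma (pos 2 ^ n))
  where
  lemma : ∀ i → pos 4 * (i * i) ≡ pos 2 * i * (pos 2 * i)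
  lemma = solve-∀

∑-subsets-1 : ∀ m → ∑ (subsets m) (λ _ → 1ℤ) ≡ pos 2 ^ m
∑-subsets-1 zero    = refl
∑-subsets-1 (suc m) = begin
  ∑ (subsets (suc m)) (λ _ → 1ℤ)                           ≡⟨ ∑-subsets-suc m _ ⟩
  ∑ (subsets m) (λ _ → 1ℤ) + ∑ (subsets m) (λ _ → 1ℤ)      ≡⟨ cong₂ _+_ (∑-subsets-1 m) (∑-subsets-1 m) ⟩
  pos 2 ^ m + pos 2 ^ m                                    ≡⟨ lemma (pos 2 ^ m) ⟩
  pos 2 ^ suc m                                            ∎
  where
  lemma : ∀ i → i + i ≡ pos 2 * i
  lemma = solve-∀

-- Counting triples with pairwise eulerian differences

module _ (G : Graph) where
  open Graph G
  open Triple G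
  open Flow ℤ₂² using
    (𝟘; balanced; flows; flows-count; flows≡∑; boundary; nowhereZero?; nowhereZeroFlows≡∑)

  private
    S = subsets ∣E∣
    P = pairs ∣E∣

  -- Symmetric difference is addition over `ℤ₂`, and the boundary is additive.
  eulerian-△ : ∀ X Y → Eulerian G X → Eulerian G Y → Eulerian G (X △ Y)
  eulerian-△ X Y eulX eulY v = even⇒2∣ _ (begin
    parity (degree G (X △ Y) v)          ≡⟨ parity-degree G (X △ Y) v ⟩
    ℤ₂.boundary tail head (X △ Y) v
      ≡⟨ ℤ₂.sum-cong-≗ (λ e → trans (cong (λ x → ℤ₂.∂ (tail e) (head e) x v) (lookup-△ X Y e))
                                     (ℤ₂.∂-∙ (tail e) (head e) (lookup X e) (lookup Y e) v)) ⟩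
    ℤ₂.sum (λ e → ℤ₂.∂ (tail e) (head e) (lookup X e) v xor ℤ₂.∂ (tail e) (head e) (lookup Y e) v)
      ≡⟨ ℤ₂.sum-∙ (λ e → ℤ₂.∂ (tail e) (head e) (lookup X e) v) _ ⟩
    ℤ₂.boundary tail head X v xor ℤ₂.boundary tail head Y v
      ≡⟨ cong₂ _xor_ (even X eulX) (even Y eulY) ⟩
    false                                ∎)
    where
    even : ∀ X → Eulerian G X → ℤ₂.boundary tail head X v ≡ false
    even X eul = trans (sym (parity-degree G X v)) (2∣⇒even (eul v))

  -- The third difference is X △ Y, which is eulerian as soon as X and Y are.
  pairwiseEulerian-△ : ∀ A X Y → does (pairwiseEulerian? (A , A △ X , A △ Y)) ≡
                                 does (eulerian? G X) ∧ does (eulerian? G Y)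
  pairwiseEulerian-△ A X Y = does-⇔
    (mk⇔ (λ (eulX , _ , eulY) → subst (Eulerian G) X≡ eulX , subst (Eulerian G) Y≡ eulY)
         (λ (eulX , eulY) → subst (Eulerian G) (sym X≡) eulX ,
           subst (Eulerian G) (sym (△-triangle A X Y)) (eulerian-△ X Y eulX eulY) ,
           subst (Eulerian G) (sym Y≡) eulY))
    (pairwiseEulerian? (A , A △ X , A △ Y)) (eulerian? G X ×-dec eulerian? G Y)
    where
    X≡ : A △ (A △ X) ≡ X
    X≡ = △-cancelˡ A X
    Y≡ : (A △ Y) △ A ≡ Y
    Y≡ = trans (△-comm (A △ Y) A) (△-cancelˡ A Y)

  ∑-Ω : ∀ h → ∑ Ω h ≡ ∑ S λ A → ∑ S λ B → ∑ S λ C → h (A , B , C)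
  ∑-Ω h = trans (∑-cartesianProductWith _,_ S (cartesianProduct S S) h)
    (∑-cong S λ A → ∑-cartesianProductWith _,_ S S λ (B , C) → h (A , B , C))

  -- For fixed A, the map B ↦ A △ B permutes the subsets, so (A , B , C) may be replaced by (A , X ,
  -- Y). The event constrains only X and Y, and its indicator leaves the sum over A.
  ∑-pairwiseEulerian : ∀ (g : Outcome → ℤ) → ∑ Ω (λ ω → ⟦ does (pairwiseEulerian? ω) ⟧ * g ω) ≡
    ∑ P λ Z → balanced (boundary tail head Z) *
      ∑ S λ A → g (A , A △ Vec.map proj₁ Z , A △ Vec.map proj₂ Z)
  ∑-pairwiseEulerian g = begin
    ∑ Ω h
      ≡⟨ ∑-Ω h ⟩
    (∑ S λ A → ∑ S λ B → ∑ S λ C → h (A , B , C))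
      ≡⟨ ∑-cong S (λ A → trans (sym (∑-△ A λ B → ∑ S λ C → h (A , B , C)))
           (∑-cong S λ X → sym (∑-△ A λ C → h (A , A △ X , C)))) ⟩
    (∑ S λ A → ∑ S λ X → ∑ S λ Y → h (A , A △ X , A △ Y))
      ≡⟨ ∑-cong S (λ A → ∑-pairs ∣E∣ λ X Y → h (A , A △ X , A △ Y)) ⟩
    (∑ S λ A → ∑ P λ Z → h (A , A △ Vec.map proj₁ Z , A △ Vec.map proj₂ Z))
      ≡⟨ ∑-swap S P (λ A Z → h (A , A △ Vec.map proj₁ Z , A △ Vec.map proj₂ Z)) ⟩
    (∑ P λ Z → ∑ S λ A → h (A , A △ Vec.map proj₁ Z , A △ Vec.map proj₂ Z))
      ≡⟨ ∑-cong P (λ Z → trans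
           (∑-cong S λ A → cong (_* g (A , A △ Vec.map proj₁ Z , A △ Vec.map proj₂ Z))
             (trans (cong ⟦_⟧ (pairwiseEulerian-△ A (Vec.map proj₁ Z) (Vec.map proj₂ Z)))
                    (sym (balanced-pair G Z))))
           (∑-distribˡ-* S (balanced (boundary tail head Z)) _)) ⟩
    (∑ P λ Z → balanced (boundary tail head Z) *
      ∑ S λ A → g (A , A △ Vec.map proj₁ Z , A △ Vec.map proj₂ Z)) ∎
    where
    h : Outcome → ℤ
    h ω = ⟦ does (pairwiseEulerian? ω) ⟧ * g ω

  t : ℤ
  t = T^ ∣E∣ sign 0

  signed-Ω : pos (length (filter sum≡0,1,2mod6? Ω)) - pos (length (filter (∁? sum≡0,1,2mod6?) Ω)) ≡
             pos (3 ℕ.^ ∣E∣) * t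
  signed-Ω = begin
    pos (length (filter sum≡0,1,2mod6? Ω)) - pos (length (filter (∁? sum≡0,1,2mod6?) Ω))
      ≡⟨ signed-count sum≡0,1,2mod6? Ω ⟩
    ∑ Ω (λ ω → ± (does (sum≡0,1,2mod6? ω)))
      ≡⟨ ∑-Ω _ ⟩
    (∑ S λ A → ∑ S λ B → ∑ S λ C → sign (∣ A ∣ ℕ.+ ∣ B ∣ ℕ.+ ∣ C ∣))
      ≡⟨ ∑-cong S (λ A → ∑-cong S λ B → ∑-cong S λ C → cong sign (lemma (∣ A ∣) (∣ B ∣) (∣ C ∣))) ⟩
    W³ ∣E∣ sign 0
      ≡⟨ W³-antiperiodic ∣E∣ sign-antiperiodic 0 ⟩
    pos 3 ^ ∣E∣ * t
      ≡⟨ cong (_* t) (pos-^ 3 ∣E∣) ⟨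
    pos (3 ℕ.^ ∣E∣) * t ∎
    where
    lemma : ∀ a b c → a ℕ.+ b ℕ.+ c ≡ c ℕ.+ (b ℕ.+ (a ℕ.+ 0))
    lemma = ℕSolver.solve-∀

  -- Being eulerian makes (X , Y) a ℤ₂ × ℤ₂-flow, and the cancellation in the sum over A leaves only
  -- those that vanish on no edge.
  signed-Δ : pos (length (filter (sum≡0,1,2mod6? ∩? pairwiseEulerian?) Ω)) -
             pos (length (filter (∁? sum≡0,1,2mod6? ∩? pairwiseEulerian?) Ω)) ≡ pos (F G 4) * t
  signed-Δ = begin
    pos (length (filter (sum≡0,1,2mod6? ∩? pairwiseEulerian?) Ω)) -
    pos (length (filter (∁? sum≡0,1,2mod6? ∩? pairwiseEulerian?) Ω))
      ≡⟨ signed-count-∩ sum≡0,1,2mod6? Ω pairwiseEulerian? ⟩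
    ∑ Ω (λ ω → ⟦ does (pairwiseEulerian? ω) ⟧ * ± (does (sum≡0,1,2mod6? ω)))
      ≡⟨ ∑-pairwiseEulerian (λ ω → ± (does (sum≡0,1,2mod6? ω))) ⟩
    (∑ P λ Z → balanced (boundary tail head Z) * ∑ S λ A → sign (size A Z))
      ≡⟨ ∑-cong P (λ Z → trans
           (cong (balanced (boundary tail head Z) *_) (∑-size sign-antiperiodic Z))
           (lemma (balanced (boundary tail head Z)) ⟦ does (nowhereZero? Z) ⟧ t)) ⟩
    (∑ P λ Z → ⟦ does (nowhereZero? Z) ⟧ * balanced (boundary tail head Z) * t)
      ≡⟨ ∑-distribʳ-* P t _ ⟩
    (∑ P λ Z → ⟦ does (nowhereZero? Z) ⟧ * balanced (boundary tail head Z)) * t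
      ≡⟨ cong (_* t) (trans (F≡nowhereZeroFlows-ℤ₂² G) (nowhereZeroFlows≡∑ tail head)) ⟨
    pos (F G 4) * t ∎
    where
    lemma : ∀ i j k → i * (j * k) ≡ j * i * k
    lemma = solve-∀

  k≤∣V∣ : k G ℕ.≤ ∣V∣
  k≤∣V∣ = ℕ.≤-trans (length-deduplicate (connected? G) (allFin ∣V∣)) (ℕ.≤-reflexive (length-tabulate id))

  flows-rank : flows tail head 𝟘 * pos 4 ^ r G ≡ pos 4 ^ ∣E∣
  flows-rank = *-cancelʳ-≡ _ _ (pos 4 ^ k G) {{4^k≢0}} (begin
    flows tail head 𝟘 * pos 4 ^ r G * pos 4 ^ k G
      ≡⟨ *-assoc (flows tail head 𝟘) (pos 4 ^ r G) (pos 4 ^ k G) ⟩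
    flows tail head 𝟘 * (pos 4 ^ r G * pos 4 ^ k G)
      ≡⟨ cong (flows tail head 𝟘 *_) (^-distribˡ-+-* (pos 4) (r G) (k G)) ⟨
    flows tail head 𝟘 * pos 4 ^ (r G ℕ.+ k G)
      ≡⟨ cong (λ n → flows tail head 𝟘 * pos 4 ^ n) (ℕ.m∸n+n≡m k≤∣V∣) ⟩
    flows tail head 𝟘 * pos 4 ^ ∣V∣
      ≡⟨ flows-count tail head ⟩
    pos 4 ^ ∣E∣ * pos 4 ^ k G ∎)
    where
    4^k≢0 : ℤ.NonZero (pos 4 ^ k G)
    4^k≢0 = ℤ.≢-nonZero λ eq → contradiction (i^n≡0⇒i≡0 (pos 4) (k G) eq) λ ()

  -- The probability of Δ is 4^(-r(G)): there are 4^(∣E∣ - r(G)) pairs (X , Y) and 2^∣E∣ sets A, out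
  -- of 8^∣E∣ triples.
  count-Δ : pos (length (filter pairwiseEulerian? Ω)) * pos (4 ℕ.^ r G) ≡ pos (length Ω)
  count-Δ = begin
    pos (length (filter pairwiseEulerian? Ω)) * pos (4 ℕ.^ r G)
      ≡⟨ cong₂ _*_ count (pos-^ 4 (r G)) ⟩
    flows tail head 𝟘 * pos 2 ^ ∣E∣ * pos 4 ^ r G
      ≡⟨ swapʳ (flows tail head 𝟘) (pos 2 ^ ∣E∣) (pos 4 ^ r G) ⟩
    flows tail head 𝟘 * pos 4 ^ r G * pos 2 ^ ∣E∣
      ≡⟨ cong (_* pos 2 ^ ∣E∣) (trans flows-rank (4^≡2^² ∣E∣)) ⟩
    pos 2 ^ ∣E∣ * pos 2 ^ ∣E∣ * pos 2 ^ ∣E∣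
      ≡⟨ total ⟨
    pos (length Ω) ∎
    where
    swapʳ : ∀ i j k → i * j * k ≡ i * k * j
    swapʳ = solve-∀

    count : pos (length (filter pairwiseEulerian? Ω)) ≡ flows tail head 𝟘 * pos 2 ^ ∣E∣
    count = begin
      pos (length (filter pairwiseEulerian? Ω))
        ≡⟨ length-filter≡∑ pairwiseEulerian? Ω ⟩
      ∑ Ω (λ ω → ⟦ does (pairwiseEulerian? ω) ⟧)
        ≡⟨ ∑-cong Ω (λ ω → *-identityʳ ⟦ does (pairwiseEulerian? ω) ⟧) ⟨
      ∑ Ω (λ ω → ⟦ does (pairwiseEulerian? ω) ⟧ * 1ℤ)
        ≡⟨ ∑-pairwiseEulerian (λ _ → 1ℤ) ⟩
      (∑ P λ Z → balanced (boundary tail head Z) * ∑ S λ _ → 1ℤ)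
        ≡⟨ ∑-distribʳ-* P (∑ S λ _ → 1ℤ) _ ⟩
      (∑ P λ Z → balanced (boundary tail head Z)) * (∑ S λ _ → 1ℤ)
        ≡⟨ cong₂ _*_ (flows≡∑ tail head) (sym (∑-subsets-1 ∣E∣)) ⟨
      flows tail head 𝟘 * pos 2 ^ ∣E∣ ∎

    total : pos (length Ω) ≡ pos 2 ^ ∣E∣ * pos 2 ^ ∣E∣ * pos 2 ^ ∣E∣
    total = begin
      pos (length Ω)                             ≡⟨ *-identityʳ _ ⟨
      pos (length Ω) * 1ℤ                        ≡⟨ ∑-const Ω 1ℤ ⟨
      ∑ Ω (λ _ → 1ℤ)                             ≡⟨ ∑-Ω _ ⟩
      (∑ S λ _ → ∑ S λ _ → ∑ S λ _ → 1ℤ)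
        -- The factor `1ℤ` is kept so that `∑-distribˡ-*` can pull `q` out of the next sum.
        ≡⟨ ∑-cong S (λ _ → ∑-cong S λ _ → trans (∑-subsets-1 ∣E∣) (sym (*-identityʳ _))) ⟩
      (∑ S λ _ → ∑ S λ _ → q * 1ℤ)
        ≡⟨ ∑-cong S (λ _ → trans (∑-distribˡ-* S q _)
             (cong (q *_) (trans (∑-subsets-1 ∣E∣) (sym (*-identityʳ _))))) ⟩
      (∑ S λ _ → q * (q * 1ℤ))
        ≡⟨ trans (∑-distribˡ-* S q _) (cong (q *_) (∑-distribˡ-* S q _)) ⟩
      q * (q * ∑ S (λ _ → 1ℤ))                   ≡⟨ cong (λ i → q * (q * i)) (∑-subsets-1 ∣E∣) ⟩
      q * (q * q)                                ≡⟨ *-assoc q q q ⟨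
      q * q * q                                  ∎
      where q = pos 2 ^ ∣E∣

open import Data.Integer.Base using (+_)

theorem2p20 : (G : Graph) → let open Graph G in let open Triple G in
    Σ[ Δ≢0 ∈ ℚ.NonZero (ℙ pairwiseEulerian?) ]
    Σ[ bias≢0 ∈ ℚ.NonZero (Bias sum≡0,1,2mod6?) ]
      _÷_ (Bias[ sum≡0,1,2mod6? ∣ pairwiseEulerian? ] {{Δ≢0}}) (Bias sum≡0,1,2mod6?) {{bias≢0}}
      ≡ + (4 ℕ.^ r G ℕ.* F G 4) / 3 ℕ.^ ∣E∣
theorem2p20 G = Δ≢0 , bias≢0 , bias-quotient
  (length (filter (sum≡0,1,2mod6? ∩? pairwiseEulerian?) Ω))
  (length (filter (∁? sum≡0,1,2mod6? ∩? pairwiseEulerian?) Ω))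
  (length (filter pairwiseEulerian? Ω))
  (length (filter sum≡0,1,2mod6? Ω))
  (length (filter (∁? sum≡0,1,2mod6?) Ω))
  (length Ω) (3 ℕ.^ ∣E∣) (F G 4) (4 ℕ.^ r G) (t G)
  (signed-Δ G) (signed-Ω G) (count-Δ G) {{Δ≢0}} {{bias≢0}}
  where
  open Graph G
  open Triple G

  Δ≢0 : ℚ.NonZero (ℙ pairwiseEulerian?)
  -- If Δ were empty, `count-Δ` would make Ω empty as well.
  Δ≢0 = ℚ.≢-nonZero (/-≢0 {pos (length (filter pairwiseEulerian? Ω))} (length Ω) λ Δ≡0 →
    ℕ.≢-nonZero⁻¹ (length Ω) (ℤ.+-injective
      (trans (sym (count-Δ G)) (cong (_* pos (4 ℕ.^ r G)) Δ≡0))))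

  bias≢0 : ℚ.NonZero (Bias sum≡0,1,2mod6?)
  -- The bias is `3^∣E∣ * t` over the size of Ω, and neither factor vanishes.
  bias≢0 = ℚ.≢-nonZero λ bias≡0 →
    /-≢0 {pos (3 ℕ.^ ∣E∣) * t G} (length Ω)
      (λ eq → [ (λ 3^≡0 → ℕ.≢-nonZero⁻¹ (3 ℕ.^ ∣E∣) (ℤ.+-injective 3^≡0)) , T^-sign-nonzero ∣E∣ ]
        (i*j≡0⇒i≡0∨j≡0 (pos (3 ℕ.^ ∣E∣)) eq))
      (trans (sym (trans (/-distrib-- (pos (length (filter sum≡0,1,2mod6? Ω)))
                                      (pos (length (filter (∁? sum≡0,1,2mod6?) Ω))) (length Ω))
                         (cong (_/ length Ω) (signed-Ω G)))) bias≡0)
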